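{- There is an algorithm whose input is a graph $G$ with $n$ vertices and $m$ edges together with a proper 4-tuple $Z$ of vertices of $G$, which runs in time $O(n+m)$ and whose output is a 2-join of $G$ compatible with $Z$ if such a 2-join exists.
   Context: Graphs are finite, simple and undirected. A partition $(X_1,X_2)$ of the vertex set of a graph $G$ is a \emph{2-join} if for $i=1,2$ there exist disjoint non-empty sets $A_i,B_i\subseteq X_i$ such that: every vertex of $A_1$ is adjacent to every vertex of $A_2$, every vertex of $B_1$ is adjacent to every vertex of $B_2$, and there are no other edges between $X_1$ and $X_2$; and $|X_i|\ge 3$ for $i=1,2$. A 4-tuple $(a_1,a_2,b_1,b_2)$ of vertices of $G=(V,E)$ is \emph{proper} if $a_1,b_1,a_2,b_2$ are pairwise distinct, $a_1a_2,b_1b_2\in E$ and $a_1b_2,b_1a_2\notin E$. It is \emph{compatible} with a 2-join $(X_1,X_2)$ of $G$ if $a_1,b_1\in X_1$ and $a_2,b_2\in X_2$. -}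

module Defs where

open import Data.Bool using (Bool; true; false; not; _∧_; if_then_else_)
open import Data.Fin as Fin using (Fin; toℕ)
open import Data.Fin.Subset using (Subset; _∈_; _⊆_; _∩_; _∪_; ∣_∣; Nonempty; Empty)
open import Data.List using (List; []; _∷_; length; map; concat; take; filter; cartesianProduct; allFin; upTo)
  renaming (tabulate to tabulateᴸ)
import Data.List.Membership.Propositional as List
open import Data.List.Relation.Unary.Unique.Propositional using (Unique)
open import Data.Maybe using (Maybe; just; nothing)
open import Data.Nat using (ℕ; zero; suc; pred; _+_; _≤_; _≡ᵇ_; _<ᵇ_)
open import Data.Product using (∃-syntax; _×_; _,_)
open import Data.Sum using (_⊎_)
open import Data.Vec using (tabulate)
open import Function.Bundles using (_⇔_)
open import Level using (0ℓ)
open import Relation.Binary using (Rel; Symmetric; Irreflexive; Decidable)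
open import Relation.Binary.PropositionalEquality using (_≡_; _≢_)
open import Relation.Nullary using (¬_)
open import Relation.Nullary.Decidable using (_×-dec_)

record Graph (n : ℕ) : Set₁ where
  field
    Adj        : Rel (Fin n) 0ℓ
    adj?       : Decidable Adj
    adj-sym    : Symmetric Adj
    adj-irrefl : Irreflexive _≡_ Adj

module _ {n : ℕ} (G : Graph n) where
  open Graph G

  -- Each edge {u, v} is listed once, as the pair with u < v.
  edges : List (Fin n × Fin n)
  edges = filter (λ { (u , v) → (u Fin.<? v) ×-dec adj? u v })
                 (cartesianProduct (allFin n) (allFin n))

  edgeCount : ℕ
  edgeCount = length edges

  record IsPartition (X₁ X₂ : Subset n) : Set where
    field
      covers   : ∀ v → v ∈ X₁ ∪ X₂
      disjoint : Empty (X₁ ∩ X₂)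

  record Is2Join (X₁ X₂ : Subset n) : Set where
    field
      partition : IsPartition X₁ X₂
      A₁ B₁ A₂ B₂ : Subset n
      A₁⊆X₁ : A₁ ⊆ X₁
      B₁⊆X₁ : B₁ ⊆ X₁
      A₂⊆X₂ : A₂ ⊆ X₂
      B₂⊆X₂ : B₂ ⊆ X₂
      A₁-nonempty : Nonempty A₁
      B₁-nonempty : Nonempty B₁
      A₂-nonempty : Nonempty A₂
      B₂-nonempty : Nonempty B₂
      A₁∩B₁-empty : Empty (A₁ ∩ B₁)
      A₂∩B₂-empty : Empty (A₂ ∩ B₂)
      A-complete : ∀ {u v} → u ∈ A₁ → v ∈ A₂ → Adj u v
      B-complete : ∀ {u v} → u ∈ B₁ → v ∈ B₂ → Adj u v
      no-other   : ∀ {u v} → u ∈ X₁ → v ∈ X₂ → Adj u v →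
                   (u ∈ A₁ × v ∈ A₂) ⊎ (u ∈ B₁ × v ∈ B₂)
      3≤∣X₁∣ : 3 ≤ ∣ X₁ ∣
      3≤∣X₂∣ : 3 ≤ ∣ X₂ ∣

record Tuple (n : ℕ) : Set where
  field
    a₁ a₂ b₁ b₂ : Fin n

record Proper {n : ℕ} (G : Graph n) (Z : Tuple n) : Set where
  open Graph G
  open Tuple Z
  field
    a₁≢a₂ : a₁ ≢ a₂
    a₁≢b₁ : a₁ ≢ b₁
    a₁≢b₂ : a₁ ≢ b₂
    a₂≢b₁ : a₂ ≢ b₁
    a₂≢b₂ : a₂ ≢ b₂
    b₁≢b₂ : b₁ ≢ b₂
    a₁a₂∈E : Adj a₁ a₂
    b₁b₂∈E : Adj b₁ b₂
    a₁b₂∉E : ¬ Adj a₁ b₂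
    b₁a₂∉E : ¬ Adj b₁ a₂

Compatible : ∀ {n} → Tuple n → Subset n → Subset n → Set
Compatible Z X₁ X₂ = (a₁ ∈ X₁ × b₁ ∈ X₁) × (a₂ ∈ X₂ × b₂ ∈ X₂)
  where open Tuple Z

Compatible2Join : ∀ {n} → Graph n → Tuple n → Subset n × Subset n → Set
Compatible2Join G Z (X₁ , X₂) = Is2Join G X₁ X₂ × Compatible Z X₁ X₂

-- The machine model is a unit-cost random access machine, programmed in a
-- small imperative language.  A program names finitely many scalar
-- registers and arrays, both by numerals.  Arithmetic is limited to
-- successor and predecessor: in t steps no number exceeds the largest
-- number in the input or the program text by more than t, so unit cost
-- cannot be abused through huge words.

infix  9 _[_]
infix  6 _==_ _<<_
infixr 5 _&&_
infix  4 _≔_ _[_]≔_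
infixr 3 _⨾_

data Expr : Set where
  lit  : ℕ → Expr
  var  : ℕ → Expr
  _[_] : ℕ → Expr → Expr
  inc  : Expr → Expr
  dec  : Expr → Expr

data Test : Set where
  _==_ : Expr → Expr → Test
  _<<_ : Expr → Expr → Test
  neg  : Test → Test
  _&&_ : Test → Test → Test

data Program : Set where
  skip    : Program
  _≔_     : ℕ → Expr → Program
  _[_]≔_  : ℕ → Expr → Expr → Program
  _⨾_     : Program → Program → Program
  cond    : Test → Program → Program → Program
  while   : Test → Program → Program

record State : Set where
  constructor state
  field
    vars : ℕ → ℕ
    arrs : ℕ → ℕ → ℕ
open State public

evalᴱ : State → Expr → ℕ
evalᴱ s (lit k)   = k
evalᴱ s (var x)   = vars s x
evalᴱ s (A [ e ]) = arrs s A (evalᴱ s e)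
evalᴱ s (inc e)   = suc (evalᴱ s e)
evalᴱ s (dec e)   = pred (evalᴱ s e)

evalᵀ : State → Test → Bool
evalᵀ s (e == f) = evalᴱ s e ≡ᵇ evalᴱ s f
evalᵀ s (e << f) = evalᴱ s e <ᵇ evalᴱ s f
evalᵀ s (neg b)  = not (evalᵀ s b)
evalᵀ s (b && c) = evalᵀ s b ∧ evalᵀ s c

costᴱ : Expr → ℕ
costᴱ (lit k)   = 1
costᴱ (var x)   = 1
costᴱ (A [ e ]) = suc (costᴱ e)
costᴱ (inc e)   = suc (costᴱ e)
costᴱ (dec e)   = suc (costᴱ e)

costᵀ : Test → ℕ
costᵀ (e == f) = suc (costᴱ e + costᴱ f)
costᵀ (e << f) = suc (costᴱ e + costᴱ f)
costᵀ (neg b)  = suc (costᵀ b)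
costᵀ (b && c) = suc (costᵀ b + costᵀ c)

update : {X : Set} → (ℕ → X) → ℕ → X → ℕ → X
update f i x j = if j ≡ᵇ i then x else f j

setVar : State → ℕ → ℕ → State
setVar s x k = state (update (vars s) x k) (arrs s)

setArr : State → ℕ → ℕ → ℕ → State
setArr s A i k = state (vars s) (update (arrs s) A (update (arrs s A) i k))

-- ⟨ P , s ⟩⇓[ t ] s′ : started in state s, the program P halts in state s′
-- after exactly t elementary steps.
infix 2 ⟨_,_⟩⇓[_]_

data ⟨_,_⟩⇓[_]_ : Program → State → ℕ → State → Set where
  ⇓skip   : ∀ {s} → ⟨ skip , s ⟩⇓[ 1 ] s
  ⇓assign : ∀ {s x e} →
            ⟨ x ≔ e , s ⟩⇓[ suc (costᴱ e) ] setVar s x (evalᴱ s e)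
  ⇓store  : ∀ {s A e f} →
            ⟨ A [ e ]≔ f , s ⟩⇓[ suc (costᴱ e + costᴱ f) ]
              setArr s A (evalᴱ s e) (evalᴱ s f)
  ⇓seq    : ∀ {P Q s s′ s″ t t′} →
            ⟨ P , s ⟩⇓[ t ] s′ → ⟨ Q , s′ ⟩⇓[ t′ ] s″ →
            ⟨ P ⨾ Q , s ⟩⇓[ t + t′ ] s″
  ⇓true   : ∀ {b P Q s s′ t} → evalᵀ s b ≡ true →
            ⟨ P , s ⟩⇓[ t ] s′ →
            ⟨ cond b P Q , s ⟩⇓[ costᵀ b + t ] s′
  ⇓false  : ∀ {b P Q s s′ t} → evalᵀ s b ≡ false →
            ⟨ Q , s ⟩⇓[ t ] s′ →
            ⟨ cond b P Q , s ⟩⇓[ costᵀ b + t ] s′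
  ⇓stop   : ∀ {b P s} → evalᵀ s b ≡ false →
            ⟨ while b P , s ⟩⇓[ costᵀ b ] s
  ⇓loop   : ∀ {b P s s′ s″ t t′} → evalᵀ s b ≡ true →
            ⟨ P , s ⟩⇓[ t ] s′ → ⟨ while b P , s′ ⟩⇓[ t′ ] s″ →
            ⟨ while b P , s ⟩⇓[ costᵀ b + t + t′ ] s″

-- The neighbours of a vertex may be listed in any order.
record AdjacencyLists {n : ℕ} (G : Graph n) : Set where
  open Graph G
  field
    nbrs        : Fin n → List (Fin n)
    nbrs-unique : ∀ v → Unique (nbrs v)
    nbrs-adj    : ∀ v u → (u List.∈ nbrs v) ⇔ Adj v u

cell : List ℕ → ℕ → ℕ
cell []       i       = 0
cell (x ∷ xs) zero    = x
cell (x ∷ xs) (suc i) = cell xs i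

-- Vertices are numbered 0, …, n - 1.  Registers 0 to 4 hold n, a₁, a₂, b₁,
-- b₂.  Array 1 is the concatenation of the adjacency lists; for i ≤ n, cell
-- i of array 0 is the position in array 1 at which the list of vertex i
-- starts (for i = n, the total length of the lists).  All other memory
-- is 0.
module _ {n : ℕ} {G : Graph n} (L : AdjacencyLists G) (Z : Tuple n) where
  open AdjacencyLists L
  open Tuple Z

  initialVars : ℕ → ℕ
  initialVars = cell (n ∷ toℕ a₁ ∷ toℕ a₂ ∷ toℕ b₁ ∷ toℕ b₂ ∷ [])

  initialArrs : ℕ → ℕ → ℕ
  initialArrs 0 = cell (map (λ i → length (concat (take i (tabulateᴸ nbrs)))) (upTo (suc n)))
  initialArrs 1 = cell (map toℕ (concat (tabulateᴸ nbrs)))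
  initialArrs _ = cell []

  initial : State
  initial = state initialVars initialArrs

-- On halting, register 5 is 0 if the program reports that there is no
-- solution; otherwise X₁ and X₂ consist of the vertices whose cell in
-- array 2 is 1 and 2, respectively.
side : ∀ n → State → ℕ → Subset n
side n s k = tabulate λ v → arrs s 2 (toℕ v) ≡ᵇ k

output : ∀ n → State → Maybe (Subset n × Subset n)
output n s with vars s 5
... | zero  = nothing
... | suc _ = just (side n s 1 , side n s 2)

Correct : ∀ {n} → Graph n → Tuple n → Maybe (Subset n × Subset n) → Set
Correct G Z (just X) = Compatible2Join G Z X
Correct G Z nothing  = ¬ (∃[ X ] Compatible2Join G Z X)

{-# OPTIONS --safe #-}

-- Fix a vertex c outside Z; a compatible 2-join (X₁ , X₂) has c on one of its
-- sides, and by symmetry suppose c ∈ X₁.  Given (p , q) = (a₁ , b₁) and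
-- (r , s) = (a₂ , b₂), membership in A₁ and B₁ (in A₂ and B₂) is read off the
-- adjacencies to r and s (to p and q), so whether v ∈ X₁ and u ∈ X₂ have to be
-- adjacent is known in advance.  If their actual adjacency disagrees, then
-- v ∈ X₁ forces u ∈ X₁.  Hence every candidate X₁ contains the closure of
-- {p , q , c} under these implications, and if there is any, then the closure is
-- one: c makes it large enough, and no candidate has a larger complement.
--
-- The closure is found by a search with a stack.  The neighbours that v forces
-- are found by scanning N(v).  The non-neighbours that v forces lie in N(p) or
-- N(q), which is too long a list to be scanned for every v.  But if w was the
-- last vertex of the same class as v, then w has already forced its own
-- non-neighbours, so it is enough to scan N(w), after which v takes over the
-- role of w.  So no list is scanned more than a bounded number of times.

module Submission where

open import Defs
open import Data.Bool using (Bool; true; false; not; _∧_; _∨_; if_then_else_)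
open import Data.Bool.Properties using (∨-conicalˡ; ∨-conicalʳ)
open import Data.Empty using (⊥)
open import Data.Fin as Fin using (Fin; toℕ)
open import Data.Fin.Patterns using (0F; 1F; 2F; 3F)
open import Data.Fin.Properties using (toℕ-injective; toℕ-fromℕ<; toℕ<n)
  renaming (suc-injective to Fin-suc-injective; <-cmp to Fin-<-cmp)
open import Data.Fin.Subset using (Subset; inside; outside; _∈_; _∉_; _⊆_; _∩_; _∪_; _-_; ⁅_⁆; ∣_∣; Empty)
open import Data.Fin.Subset.Properties using
  (p⊆q⇒∣p∣≤∣q∣; x∈p⇒∣p-x∣<∣p∣; x∈p∧x≢y⇒x∈p-y; ∣⁅x⁆∣≡1; x∈⁅x⁆; x∈p∪q⁺; x∈p∪q⁻; x∈p∩q⁺; x∈p∩q⁻;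
      ∪-comm; ∩-comm)
open import Data.List using (List; []; _∷_; _++_; length; map; concat; take; applyUpTo)
  renaming (tabulate to tabulateᴸ)
open import Data.List.Membership.Propositional using () renaming (_∈_ to _∈ᴸ_)
open import Data.List.Membership.Propositional.Properties using
  (∈-++⁺ˡ; ∈-++⁺ʳ; ∈-++⁻; ∈-∃++; ∈-map⁺; ∈-map⁻; ∈-concat⁻′; ∈-tabulate⁻; ∈-filter⁺;
      ∈-cartesianProduct⁺; ∈-allFin)
open import Data.List.Properties using (length-++; length-map; ++-assoc)
open import Data.List.Relation.Unary.All using () renaming (lookup to All-lookup)
import Data.List.Relation.Unary.All.Properties as All
open import Data.List.Relation.Unary.AllPairs using ([]; _∷_)
import Data.List.Relation.Unary.AllPairs.Properties as AllPairs
open import Data.List.Relation.Unary.Any using (here; there)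
open import Data.List.Relation.Unary.Unique.Propositional using (Unique)
import Data.List.Relation.Unary.Unique.Propositional.Properties as Unique
open import Data.Maybe using (just; nothing)
open import Data.Nat using (ℕ; zero; suc; pred; _+_; _*_; _≤_; _<_; _≡ᵇ_; z≤n; s≤s)
open import Data.Nat.Properties
open import Data.Nat.Solver using (module +-*-Solver)
open import Data.Product using (∃-syntax; _×_; _,_; proj₁; proj₂; swap)
open import Data.Product.Properties using (,-injectiveˡ; ,-injectiveʳ)
open import Data.Sum as Sum using (_⊎_; inj₁; inj₂)
open import Data.Vec using ([]; _∷_; tabulate)
open import Data.Vec.Functional using (updateAt)
open import Data.Vec.Functional.Properties using (updateAt-updates; updateAt-minimal)
open import Data.Vec.Properties using (lookup∘tabulate; lookup⇒[]=; []=⇒lookup)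
open import Algebra.Properties.Semiring.Sum +-*-semiring using (sum; sum-cong-≗; *-distribˡ-sum)
open import Function using (id; _∘_; case_of_; const)
open import Function.Bundles using (module Equivalence)
open import Relation.Binary.Definitions using (tri<; tri≈; tri>)
open import Relation.Binary.PropositionalEquality hiding ([_])
open import Relation.Nullary using (Dec; yes; no; does; ¬_; contradiction)
open import Relation.Nullary.Decidable using (dec-true; dec-false; decidable-stable; ¬?; _×-dec_)

-- The combinatorics of `Forced` never mentions the machine, and the exploration never mentions
-- 2-joins; the interface is a flag array for `Forced`. No decision procedure for `Forced` is
-- assumed: the terminated run itself supplies one. The closure is computed for one role assignment
-- `p`, `q`, `r`, `s`. If it fails, every remaining candidate has `c` on the other side, and the
-- same program is run with the sides exchanged, so the working arrays must be reset. Two obstacles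
-- shape the time bound. Testing adjacency to the current vertex must take constant time without
-- resetting an array for each vertex: neighbours of `v` receive the stamp v + 1, a value no other
-- vertex uses. And one step may scan the long list of the reference vertex `w`: this is amortised
-- by a deposit of 2 deg w, made when `w` becomes the reference vertex and spent when it is
-- replaced. Costs are first measured in `suc (n + total)`, `total` being the sum of the degrees;
-- only the last step compares this with n + m.

update-same : ∀ {X : Set} (f : ℕ → X) i {x} → update f i x i ≡ x
-- The Boolean part of `i ≟ i` computes to `i ≡ᵇ i`, the test inside `update`.
update-same f i {x} = cong (λ b → if b then x else f i) (dec-true (i ≟ i) refl)

update-other : ∀ {X : Set} (f : ℕ → X) {i j x} → j ≢ i → update f i x j ≡ f j
update-other f {i} {j} {x} j≢i =
  cong (λ b → if b then x else f j) (dec-false (j ≟ i) j≢i)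

-- Failure is defined by its own recursion and not as a negation, so that a failed conjunction
-- yields a disjunction to split on.
Holds Fails : State → Test → Set
Holds s (e == f) = evalᴱ s e ≡ evalᴱ s f
Holds s (e << f) = evalᴱ s e < evalᴱ s f
Holds s (neg b)  = Fails s b
Holds s (b && c) = Holds s b × Holds s c
Fails s (e == f) = evalᴱ s e ≢ evalᴱ s f
Fails s (e << f) = evalᴱ s f ≤ evalᴱ s e
Fails s (neg b)  = Holds s b
Fails s (b && c) = Fails s b ⊎ Fails s c

holds⇒true  : ∀ {s} b → Holds s b → evalᵀ s b ≡ true
fails⇒false : ∀ {s} b → Fails s b → evalᵀ s b ≡ false
holds⇒true (e == f) h = dec-true (_ ≟ _) h
holds⇒true (e << f) h = dec-true (_ <? _) h
holds⇒true (neg b) h = cong not (fails⇒false b h)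
holds⇒true (b && c) (h , k) = cong₂ _∧_ (holds⇒true b h) (holds⇒true c k)
fails⇒false (e == f) h = dec-false (_ ≟ _) h
fails⇒false (e << f) h = dec-false (_ <? _) (≤⇒≯ h)
fails⇒false (neg b) h = cong not (holds⇒true b h)
fails⇒false {s} (b && c) (inj₁ h) rewrite fails⇒false {s} b h = refl
fails⇒false {s} (b && c) (inj₂ h) rewrite fails⇒false {s} c h with evalᵀ s b
... | true  = refl
... | false = refl

holds⊎fails : ∀ s b → Holds s b ⊎ Fails s b
holds⊎fails s (e == f) with evalᴱ s e ≟ evalᴱ s f
... | yes h = inj₁ h
... | no  h = inj₂ h
holds⊎fails s (e << f) = <-≤-connex (evalᴱ s e) (evalᴱ s f)
holds⊎fails s (neg b) with holds⊎fails s b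
... | inj₁ h = inj₂ h
... | inj₂ h = inj₁ h
holds⊎fails s (b && c) with holds⊎fails s b | holds⊎fails s c
... | inj₁ h | inj₁ k = inj₁ (h , k)
... | inj₁ h | inj₂ k = inj₂ (inj₂ k)
... | inj₂ h | _      = inj₂ (inj₁ h)

-- A program logic with running times

-- Syntactic and computable: for a concrete program and register the side condition of a frame
-- argument is proved by `refl`.
writesVar : Program → ℕ → Bool
writesVar skip x = false
writesVar (y ≔ e) x = x ≡ᵇ y
writesVar (A [ e ]≔ f) x = false
writesVar (P ⨾ Q) x = writesVar P x ∨ writesVar Q x
writesVar (cond b P Q) x = writesVar P x ∨ writesVar Q x
writesVar (while b P) x = writesVar P x

writesArr : Program → ℕ → Bool
writesArr skip B = false
writesArr (y ≔ e) B = false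
writesArr (A [ e ]≔ f) B = B ≡ᵇ A
writesArr (P ⨾ Q) B = writesArr P B ∨ writesArr Q B
writesArr (cond b P Q) B = writesArr P B ∨ writesArr Q B
writesArr (while b P) B = writesArr P B

record Unchanged (P : Program) (s s′ : State) : Set where
  constructor unchanged
  field
    var≡ : ∀ x → writesVar P x ≡ false → vars s′ x ≡ vars s x
    arr≡ : ∀ A → writesArr P A ≡ false → arrs s′ A ≡ arrs s A
open Unchanged public

Unchanged-refl : ∀ {P s} → Unchanged P s s
Unchanged-refl = unchanged (λ _ _ → refl) (λ _ _ → refl)

Unchanged-trans : ∀ {P s s′ s″} → Unchanged P s s′ → Unchanged P s′ s″ → Unchanged P s s″
Unchanged-trans u v = unchanged (λ x h → trans (var≡ v x h) (var≡ u x h))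
                                (λ A h → trans (arr≡ v A h) (arr≡ u A h))

writes-⨾ˡ : ∀ {P Q s s′} → Unchanged P s s′ → Unchanged (P ⨾ Q) s s′
writes-⨾ˡ u = unchanged (λ x h → var≡ u x (∨-conicalˡ _ _ h)) (λ A h → arr≡ u A (∨-conicalˡ _ _ h))

writes-⨾ʳ : ∀ {P Q s s′} → Unchanged Q s s′ → Unchanged (P ⨾ Q) s s′
writes-⨾ʳ u = unchanged (λ x h → var≡ u x (∨-conicalʳ _ _ h)) (λ A h → arr≡ u A (∨-conicalʳ _ _ h))

frame : ∀ {P s t s′} → ⟨ P , s ⟩⇓[ t ] s′ → Unchanged P s s′
frame ⇓skip = Unchanged-refl
frame {x ≔ e} {s} ⇓assign =
  unchanged (λ y h → cong (λ b → if b then evalᴱ s e else vars s y) h) (λ _ _ → refl)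
frame {A [ e ]≔ f} {s} ⇓store =
  unchanged (λ _ _ → refl)
            (λ B h → cong (λ b → if b then update (arrs s A) (evalᴱ s e) (evalᴱ s f) else arrs s B) h)
frame (⇓seq p q) = Unchanged-trans (writes-⨾ˡ (frame p)) (writes-⨾ʳ (frame q))
frame (⇓true _ p) with u ← frame p =
  unchanged (λ x h → var≡ u x (∨-conicalˡ _ _ h)) (λ A h → arr≡ u A (∨-conicalˡ _ _ h))
frame (⇓false _ p) with u ← frame p =
  unchanged (λ x h → var≡ u x (∨-conicalʳ _ _ h)) (λ A h → arr≡ u A (∨-conicalʳ _ _ h))
frame (⇓stop _) = Unchanged-refl
frame {while b P} (⇓loop _ p q) with u ← frame p | v ← frame q =
  unchanged (λ x h → trans (var≡ v x h) (var≡ u x h)) (λ A h → trans (arr≡ v A h) (arr≡ u A h))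

-- The semantics counts exactly; weakening the count to a bound here gives paths of different
-- lengths a common running time.
Runs : Program → State → ℕ → (State → Set) → Set
Runs P s T Q = ∃[ s′ ] ∃[ t ] ((⟨ P , s ⟩⇓[ t ] s′) × t ≤ T × Q s′)

Runs-mono : ∀ {P s T T′ Q Q′} → T ≤ T′ → (∀ {s′} → Unchanged P s s′ → Q s′ → Q′ s′) →
            Runs P s T Q → Runs P s T′ Q′
Runs-mono T≤ imp (s′ , t , p , t≤ , q) = s′ , t , p , ≤-trans t≤ T≤ , imp (frame p) q

Runs-⨾ : ∀ {P R s T₁ T₂ Q Q′} → Runs P s T₁ Q →
         (∀ {s′} → Unchanged P s s′ → Q s′ → Runs R s′ T₂ Q′) → Runs (P ⨾ R) s (T₁ + T₂) Q′
Runs-⨾ (s′ , t , p , t≤ , q) rest with rest (frame p) q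
... | s″ , t′ , p′ , t′≤ , q′ = s″ , t + t′ , ⇓seq p p′ , +-mono-≤ t≤ t′≤ , q′

-- Both branches are charged, so that bounds remain plain sums; this only affects constants.
Runs-cond : ∀ {b P R s T₁ T₂ Q} → (Holds s b → Runs P s T₁ Q) → (Fails s b → Runs R s T₂ Q) →
            Runs (cond b P R) s (costᵀ b + (T₁ + T₂)) Q
Runs-cond {b} {s = s} th el with holds⊎fails s b
... | inj₁ h with th h
...   | s′ , t , p , t≤ , q = s′ , _ , ⇓true (holds⇒true b h) p , +-monoʳ-≤ (costᵀ b) (m≤n⇒m≤n+o _ t≤) , q
Runs-cond {b} {s = s} th el | inj₂ h with el h
...   | s′ , t , p , t≤ , q = s′ , _ , ⇓false (fails⇒false b h) p , +-monoʳ-≤ (costᵀ b) (m≤n⇒m≤o+n _ t≤) , q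

-- Loops are verified by the rules below, so a weakest precondition is only
-- needed for loop-free programs.
wp : Program → (State → Set) → State → Set
wp skip Q s = Q s
wp (x ≔ e) Q s = Q (setVar s x (evalᴱ s e))
wp (A [ e ]≔ f) Q s = Q (setArr s A (evalᴱ s e) (evalᴱ s f))
wp (P ⨾ R) Q s = wp P (wp R Q) s
wp (cond b P R) Q s = (Holds s b → wp P Q s) × (Fails s b → wp R Q s)
wp (while b P) Q s = ⊥

bound : Program → ℕ
bound skip = 1
bound (x ≔ e) = suc (costᴱ e)
bound (A [ e ]≔ f) = suc (costᴱ e + costᴱ f)
bound (P ⨾ R) = bound P + bound R
bound (cond b P R) = costᵀ b + (bound P + bound R)
-- Any value is sound, since `wp` of a loop is `⊥`.
bound (while b P) = 0

Runs-wp : ∀ P {s Q} → wp P Q s → Runs P s (bound P) Q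
Runs-wp skip q = _ , _ , ⇓skip , ≤-refl , q
Runs-wp (x ≔ e) q = _ , _ , ⇓assign , ≤-refl , q
Runs-wp (A [ e ]≔ f) q = _ , _ , ⇓store , ≤-refl , q
Runs-wp (P ⨾ R) q = Runs-⨾ (Runs-wp P q) (λ _ → Runs-wp R)
Runs-wp (cond b P R) (th , el) = Runs-cond (λ h → Runs-wp P (th h)) (λ h → Runs-wp R (el h))

while-unfold : ∀ {b P s T T′ Q Q′} → Holds s b → Runs P s T Q →
               (∀ {s′} → Unchanged P s s′ → Q s′ → Runs (while b P) s′ T′ Q′) →
               Runs (while b P) s (costᵀ b + T + T′) Q′
while-unfold {b} h (s′ , t , p , t≤ , q) rest with rest (frame p) q
... | s″ , t′ , p′ , t′≤ , q′ =
  s″ , _ , ⇓loop (holds⇒true b h) p p′ , +-mono-≤ (+-monoʳ-≤ (costᵀ b) t≤) t′≤ , q′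

while-stop : ∀ {b P s T} {Q : State → Set} → Fails s b → costᵀ b ≤ T → Q s → Runs (while b P) s T Q
while-stop {b} h c≤ q = _ , _ , ⇓stop (fails⇒false b h) , c≤ , q

-- Inv u s says that s satisfies the invariant and that u units of time, of κ
-- steps each, are left.
while-rule : ∀ b P κ (Inv : ℕ → State → Set) →
             (∀ {u s} → Inv u s → Holds s b →
              ∃[ d ] ∃[ T ] ((costᵀ b + T ≤ κ * suc d)
                × Runs P s T λ s′ → ∃[ u′ ] (suc d + u′ ≤ u × Inv u′ s′))) →
             ∀ {u s} → Inv u s →
             Runs (while b P) s (κ * u + costᵀ b) λ s′ → (∃[ u′ ] Inv u′ s′) × Fails s′ b
while-rule b P κ Inv step {u} i = go u ≤-refl i
  where
  -- Every iteration consumes at least one unit, so the supply of units also bounds the recursion.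
  go : ∀ fuel {u s} → u ≤ fuel → Inv u s →
       Runs (while b P) s (κ * u + costᵀ b) λ s′ → (∃[ u′ ] Inv u′ s′) × Fails s′ b
  go fuel {u} {s} u≤ i with holds⊎fails s b
  ... | inj₂ h = while-stop {b} h (m≤n+m _ (κ * u)) ((u , i) , h)
  ... | inj₁ h with step i h
  ...   | d , T , c≤ , s′ , t , p , t≤ , u′ , u′≤ , i′ with fuel
  ...     | zero = contradiction (≤-trans u′≤ u≤) λ ()
  ...     | suc fuel′ with go fuel′ (≤-pred (≤-trans (s≤s (m≤n+m u′ d)) (≤-trans u′≤ u≤))) i′
  ...       | s″ , t′ , p′ , t′≤ , q′ = s″ , _ , ⇓loop (holds⇒true b h) p p′ , le , q′
    where
    open ≤-Reasoning
    le : costᵀ b + t + t′ ≤ κ * u + costᵀ b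
    le = begin
      costᵀ b + t + t′                     ≤⟨ +-mono-≤ (≤-trans (+-monoʳ-≤ (costᵀ b) t≤) c≤) t′≤ ⟩
      κ * suc d + (κ * u′ + costᵀ b)       ≡⟨ +-assoc (κ * suc d) _ _ ⟨
      κ * suc d + κ * u′ + costᵀ b         ≡⟨ cong (_+ costᵀ b) (*-distribˡ-+ κ (suc d) u′) ⟨
      κ * (suc d + u′) + costᵀ b           ≤⟨ +-monoˡ-≤ (costᵀ b) (*-monoʳ-≤ κ u′≤) ⟩
      κ * u + costᵀ b                      ∎

-- Names starting with r denote registers, names starting with a denote arrays.

rI rE rU : ℕ
rI = 11
rE = 12
rU = 13

forRange : Program → Program
forRange P = rI ≔ lit 0 ⨾ while (var rI << var 0) (P ⨾ rI ≔ inc (var rI))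

-- The loop itself writes `rI`, hence the demand that the invariant ignore `rI`. Test and increment
-- cost six steps per round; the extra round in `suc n` pays for the initialisation and the last,
-- failing test.
forRange-rule : ∀ P {n s₀} (Inv : ℕ → State → Set) →
  writesVar P 0 ≡ false → writesVar P rI ≡ false →
  (∀ {k s i} → Inv k s → Inv k (setVar s rI i)) →
  (∀ {s} (i : Fin n) → Unchanged (forRange P) s₀ s → vars s rI ≡ toℕ i →
   Inv (toℕ i) s → wp P (Inv (suc (toℕ i))) s) →
  vars s₀ 0 ≡ n → Inv 0 s₀ → Runs (forRange P) s₀ ((6 + bound P) * suc n) (Inv n)
forRange-rule P {n} {s₀} Inv w0 wI stable step n≡ inv0 =
  Runs-mono le (λ _ q → q)
    (Runs-⨾ (Runs-wp (rI ≔ lit 0) {Q = λ s → s ≡ setVar s₀ rI 0} refl)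
      λ { {s} u refl → go n 0 (+-identityʳ n)
          (writes-⨾ˡ {Q = while (var rI << var 0) (P ⨾ rI ≔ inc (var rI))} u) refl n≡ (stable inv0) })
  where
  body = P ⨾ rI ≔ inc (var rI)
  loop = while (var rI << var 0) body
  κ = 6 + bound P
  open ≤-Reasoning
  go : ∀ m k {s} → m + k ≡ n → Unchanged (forRange P) s₀ s → vars s rI ≡ k → vars s 0 ≡ n → Inv k s →
       Runs loop s (κ * m + 3) (Inv n)
  go zero k refl u eI e0 inv =
    while-stop (≤-reflexive (trans e0 (sym eI))) (m≤n+m 3 _) inv
  go (suc m) k {s} eq u eI e0 inv =
    Runs-mono le′ (λ _ q → q)
      (while-unfold (subst₂ _<_ (sym eI) (sym e0) k<n)
        (Runs-⨾ (Runs-wp P (step i u (trans eI (sym i≡)) (subst (λ j → Inv j s) (sym i≡) inv)))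
          λ u′ q → Runs-wp (rI ≔ inc (var rI))
            {Q = λ s → Inv (suc k) s × vars s rI ≡ suc k}
            (stable (subst (λ j → Inv (suc j) _) i≡ q) , cong suc (trans (var≡ u′ rI wI) eI)))
        λ { u′ (q , e) → go m (suc k) (trans (+-suc m k) eq)
              (Unchanged-trans u (writes-⨾ʳ {P = rI ≔ lit 0} (unchanged (var≡ u′) (arr≡ u′))))
              e (trans (var≡ u′ 0 (cong (_∨ false) w0)) e0) q })
    where
    k<n : k < n
    k<n = subst (k <_) eq (s≤s (m≤n+m k m))
    i = Fin.fromℕ< k<n
    i≡ : toℕ i ≡ k
    i≡ = toℕ-fromℕ< k<n
    le′ : 3 + (bound P + 3) + (κ * m + 3) ≤ κ * suc m + 3
    le′ = ≤-reflexive (trans (sym (+-assoc (3 + (bound P + 3)) (κ * m) 3))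
            (cong (_+ 3) (trans (cong (λ z → 3 + z + κ * m) (+-comm (bound P) 3)) (sym (*-suc κ m)))))
  le : 2 + (κ * n + 3) ≤ κ * suc n
  le = begin
    2 + (κ * n + 3)   ≡⟨ cong (2 +_) (+-comm (κ * n) 3) ⟩
    5 + κ * n         ≤⟨ +-monoˡ-≤ (κ * n) (m≤m+n 5 (suc (bound P))) ⟩
    5 + suc (bound P) + κ * n ≡⟨ *-suc κ n ⟨
    κ * suc n         ∎

data Segment {n : ℕ} (f : ℕ → ℕ) : ℕ → List (Fin n) → Set where
  []  : ∀ {l} → Segment f l []
  _∷_ : ∀ {l x xs} → f l ≡ toℕ x → Segment f (suc l) xs → Segment f l (x ∷ xs)

-- Forced vertices

true⇒∈tabulate : ∀ {n} {f : Fin n → _} {v} → f v ≡ true → v ∈ tabulate f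
true⇒∈tabulate {f = f} {v} h = lookup⇒[]= v _ (trans (lookup∘tabulate f v) h)

∈tabulate⇒true : ∀ {n} {f : Fin n → _} {v} → v ∈ tabulate f → f v ≡ true
∈tabulate⇒true {f = f} {v} h = trans (sym (lookup∘tabulate f v)) ([]=⇒lookup h)

3≤∣p∣ : ∀ {n} {p : Subset n} {x y z} → x ∈ p → y ∈ p → z ∈ p → x ≢ y → x ≢ z → y ≢ z → 3 ≤ ∣ p ∣
3≤∣p∣ {p = p} {x} {y} {z} x∈ y∈ z∈ x≢y x≢z y≢z =
  ≤-trans (s≤s (≤-trans (s≤s (≤-trans (s≤s z≤n) (x∈p⇒∣p-x∣<∣p∣ x∈″))) (x∈p⇒∣p-x∣<∣p∣ y∈′)))
          (x∈p⇒∣p-x∣<∣p∣ z∈)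
  where
  y∈′ : y ∈ p - z
  y∈′ = x∈p∧x≢y⇒x∈p-y y∈ y≢z
  x∈″ : x ∈ (p - z) - y
  x∈″ = x∈p∧x≢y⇒x∈p-y (x∈p∧x≢y⇒x∈p-y x∈ x≢z) x≢y

∣p∪q∣≤∣p∣+∣q∣ : ∀ {n} (p q : Subset n) → ∣ p ∪ q ∣ ≤ ∣ p ∣ + ∣ q ∣
∣p∪q∣≤∣p∣+∣q∣ [] [] = z≤n
∣p∪q∣≤∣p∣+∣q∣ (outside ∷ p) (outside ∷ q) = ∣p∪q∣≤∣p∣+∣q∣ p q
∣p∪q∣≤∣p∣+∣q∣ (outside ∷ p) (inside ∷ q) =
  ≤-trans (s≤s (∣p∪q∣≤∣p∣+∣q∣ p q)) (≤-reflexive (sym (+-suc ∣ p ∣ ∣ q ∣)))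
∣p∪q∣≤∣p∣+∣q∣ (inside ∷ p) (outside ∷ q) = s≤s (∣p∪q∣≤∣p∣+∣q∣ p q)
∣p∪q∣≤∣p∣+∣q∣ (inside ∷ p) (inside ∷ q) =
  s≤s (≤-trans (∣p∪q∣≤∣p∣+∣q∣ p q) (+-monoʳ-≤ ∣ p ∣ (n≤1+n ∣ q ∣)))

pair-small : ∀ {n} {p : Subset n} {x y} → (∀ {v} → v ∈ p → v ≡ x ⊎ v ≡ y) → ¬ 3 ≤ ∣ p ∣
pair-small {p = p} {x} {y} h 3≤ = <-irrefl refl (begin-strict
  2                      <⟨ 3≤ ⟩
  ∣ p ∣                  ≤⟨ p⊆q⇒∣p∣≤∣q∣ sub ⟩
  ∣ ⁅ x ⁆ ∪ ⁅ y ⁆ ∣      ≤⟨ ∣p∪q∣≤∣p∣+∣q∣ ⁅ x ⁆ ⁅ y ⁆ ⟩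
  ∣ ⁅ x ⁆ ∣ + ∣ ⁅ y ⁆ ∣  ≡⟨ cong₂ _+_ (∣⁅x⁆∣≡1 x) (∣⁅x⁆∣≡1 y) ⟩
  2                      ∎)
  where
  open ≤-Reasoning
  sub : p ⊆ ⁅ x ⁆ ∪ ⁅ y ⁆
  sub v∈ with h v∈
  ... | inj₁ refl = x∈p∪q⁺ (inj₁ (x∈⁅x⁆ x))
  ... | inj₂ refl = x∈p∪q⁺ (inj₂ (x∈⁅x⁆ y))

Is2Join-sym : ∀ {n} {G : Graph n} {X₁ X₂} → Is2Join G X₁ X₂ → Is2Join G X₂ X₁
Is2Join-sym {G = G} {X₁} {X₂} J = record
  { partition = record
    { covers   = λ v → subst (v ∈_) (∪-comm X₁ X₂) (covers v)
    ; disjoint = subst Empty (∩-comm X₁ X₂) disjoint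
    }
  ; A₁ = A₂ ; B₁ = B₂ ; A₂ = A₁ ; B₂ = B₁
  ; A₁⊆X₁ = A₂⊆X₂ ; B₁⊆X₁ = B₂⊆X₂ ; A₂⊆X₂ = A₁⊆X₁ ; B₂⊆X₂ = B₁⊆X₁
  ; A₁-nonempty = A₂-nonempty ; B₁-nonempty = B₂-nonempty
  ; A₂-nonempty = A₁-nonempty ; B₂-nonempty = B₁-nonempty
  ; A₁∩B₁-empty = A₂∩B₂-empty ; A₂∩B₂-empty = A₁∩B₁-empty
  ; A-complete = λ u∈ v∈ → adj-sym (A-complete v∈ u∈)
  ; B-complete = λ u∈ v∈ → adj-sym (B-complete v∈ u∈)
  ; no-other = no-other′
  ; 3≤∣X₁∣ = 3≤∣X₂∣ ; 3≤∣X₂∣ = 3≤∣X₁∣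
  }
  where
  open Graph G
  open Is2Join J
  open IsPartition partition
  no-other′ : ∀ {u v} → u ∈ X₂ → v ∈ X₁ → Adj u v → (u ∈ A₂ × v ∈ A₁) ⊎ (u ∈ B₂ × v ∈ B₁)
  no-other′ u∈ v∈ uv with no-other v∈ u∈ (adj-sym uv)
  ... | inj₁ (a , b) = inj₁ (b , a)
  ... | inj₂ (a , b) = inj₂ (b , a)

-- Allows the edge `pr` to be taken, without loss of generality, between `A₁` and `A₂`.
Is2Join-swapAB : ∀ {n} {G : Graph n} {X₁ X₂} → Is2Join G X₁ X₂ → Is2Join G X₁ X₂
Is2Join-swapAB J = record
  { partition = partition
  ; A₁ = B₁ ; B₁ = A₁ ; A₂ = B₂ ; B₂ = A₂
  ; A₁⊆X₁ = B₁⊆X₁ ; B₁⊆X₁ = A₁⊆X₁ ; A₂⊆X₂ = B₂⊆X₂ ; B₂⊆X₂ = A₂⊆X₂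
  ; A₁-nonempty = B₁-nonempty ; B₁-nonempty = A₁-nonempty
  ; A₂-nonempty = B₂-nonempty ; B₂-nonempty = A₂-nonempty
  ; A₁∩B₁-empty = subst Empty (∩-comm A₁ B₁) A₁∩B₁-empty
  ; A₂∩B₂-empty = subst Empty (∩-comm A₂ B₂) A₂∩B₂-empty
  ; A-complete = B-complete ; B-complete = A-complete
  ; no-other = λ u∈ v∈ uv → Sum.swap (no-other u∈ v∈ uv)
  ; 3≤∣X₁∣ = 3≤∣X₁∣ ; 3≤∣X₂∣ = 3≤∣X₂∣
  }
  where open Is2Join J

-- The default d is 0 on one side of the 2-join and 4 on the other, so that two
-- vertices without a class never match.
code : ∀ {A B : Set} → ℕ → Dec A → Dec B → ℕ
code d (yes _) (yes _) = 3
code d (yes _) (no _)  = 1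
code d (no _)  (yes _) = 2
code d (no _)  (no _)  = d

code≡3⁺ : ∀ {A B : Set} {d} (a : Dec A) (b : Dec B) → A → B → code d a b ≡ 3
code≡3⁺ (yes _) (yes _) _ _ = refl
code≡3⁺ (no ¬a) _ a _ = contradiction a ¬a
code≡3⁺ (yes _) (no ¬b) _ b = contradiction b ¬b

code≡3⁻ : ∀ {A B : Set} (a : Dec A) (b : Dec B) → code 0 a b ≡ 3 → A × B
code≡3⁻ (yes x) (yes y) _ = x , y
code≡3⁻ (yes _) (no _) ()
code≡3⁻ (no _) (yes _) ()
code≡3⁻ (no _) (no _) ()

-- The exclusions matter: a vertex of code 3 would share a neighbourhood with one of code 1 and
-- still not match it.
code-match⁺ : ∀ {A B C D : Set} (a : Dec A) (b : Dec B) (c : Dec C) (d : Dec D) →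
              ¬ (A × B) → ¬ (C × D) → (A × C) ⊎ (B × D) → code 0 a b ≡ code 4 c d
code-match⁺ (yes x) (yes y) _ _ ¬ab _ _ = contradiction (x , y) ¬ab
code-match⁺ _ _ (yes x) (yes y) _ ¬cd _ = contradiction (x , y) ¬cd
code-match⁺ (yes _) (no _) (yes _) (no _) _ _ _ = refl
code-match⁺ (no _) (yes _) (no _) (yes _) _ _ _ = refl
code-match⁺ (no ¬x) _ _ _ _ _ (inj₁ (x , _)) = contradiction x ¬x
code-match⁺ _ _ (no ¬x) _ _ _ (inj₁ (_ , x)) = contradiction x ¬x
code-match⁺ _ (no ¬x) _ _ _ _ (inj₂ (x , _)) = contradiction x ¬x
code-match⁺ _ _ _ (no ¬x) _ _ (inj₂ (_ , x)) = contradiction x ¬x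

code-match⁻ : ∀ {A B C D : Set} (a : Dec A) (b : Dec B) (c : Dec C) (d : Dec D) →
              ¬ (A × B) → code 0 a b ≡ code 4 c d → (A × C) ⊎ (B × D)
code-match⁻ (yes x) (yes y) _ _ ¬ab _ = contradiction (x , y) ¬ab
code-match⁻ (yes x) (no _) (yes y) (no _) _ _ = inj₁ (x , y)
code-match⁻ (no _) (yes x) (no _) (yes y) _ _ = inj₂ (x , y)
code-match⁻ (yes _) (no _) (yes _) (yes _) _ ()
code-match⁻ (yes _) (no _) (no _) (yes _) _ ()
code-match⁻ (yes _) (no _) (no _) (no _) _ ()
code-match⁻ (no _) (yes _) (yes _) (yes _) _ ()
code-match⁻ (no _) (yes _) (yes _) (no _) _ ()
code-match⁻ (no _) (yes _) (no _) (no _) _ ()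
code-match⁻ (no _) (no _) (yes _) (yes _) _ ()
code-match⁻ (no _) (no _) (yes _) (no _) _ ()
code-match⁻ (no _) (no _) (no _) (yes _) _ ()
code-match⁻ (no _) (no _) (no _) (no _) _ ()

record Marked {n : ℕ} (G : Graph n) (p q r s : Fin n) : Set where
  open Graph G
  field
    p≢q : p ≢ q
    r≢s : r ≢ s
    pr  : Adj p r
    qs  : Adj q s
    ¬ps : ¬ Adj p s
    ¬qr : ¬ Adj q r

module _ {n : ℕ} (G : Graph n) (p q r s c : Fin n) where
  open Graph G

  cls opp : Fin n → ℕ
  cls v = code 0 (adj? r v) (adj? s v)
  opp u = code 4 (adj? p u) (adj? q u)

  -- If (X₁ , X₂) is a 2-join with p, q ∈ X₁ and r, s ∈ X₂, then v ∈ X₁ and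
  -- u ∈ X₂ are adjacent exactly when cls v ≡ opp u; so a conflict at (v , u)
  -- with v ∈ X₁ forces u ∈ X₁.
  Conflict : Fin n → Fin n → Set
  Conflict v u = (Adj v u × cls v ≢ opp u) ⊎ (¬ Adj v u × cls v ≡ opp u)

  data Forced : Fin n → Set where
    seed-p : Forced p
    seed-q : Forced q
    seed-c : Forced c
    forces : ∀ {v u} → Forced v → Conflict v u → Forced u

  -- The obstructions to lying in `X₁`: a vertex of class 3 would belong to both `A₁` and `B₁`, and
  -- `r` and `s` belong to `X₂`.
  Allowed : Fin n → Set
  Allowed v = cls v ≢ 3 × v ≢ r × v ≢ s

  -- A disjunction at every vertex, as a painted array delivers it; in particular it decides
  -- `Forced`.
  Separates : Subset n → Subset n → Set
  Separates X₁ X₂ = ∀ v → (Forced v × v ∈ X₁ × v ∉ X₂) ⊎ (¬ Forced v × v ∈ X₂ × v ∉ X₁)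

  module _ (M : Marked G p q r s) where
    open Marked M

    private
     module _ {X₁ X₂} (J : Is2Join G X₁ X₂) (p∈A : p ∈ Is2Join.A₁ J) (r∈A : r ∈ Is2Join.A₂ J)
              (p∈ : p ∈ X₁) (q∈ : q ∈ X₁) (c∈ : c ∈ X₁) (r∈ : r ∈ X₂) (s∈ : s ∈ X₂) where
      open Is2Join J
      open IsPartition partition
      q∈B×s∈B : q ∈ B₁ × s ∈ B₂
      q∈B×s∈B with no-other q∈ s∈ qs
      -- Were `qs` an edge between the A-sets as well, completeness would make `p` adjacent to `s`.
      ... | inj₁ (_ , s∈A) = contradiction (A-complete p∈A s∈A) ¬ps
      ... | inj₂ h = h
      A₁⁻ : ∀ {v} → v ∈ X₁ → Adj r v → v ∈ A₁
      A₁⁻ v∈ rv with no-other v∈ r∈ (adj-sym rv)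
      ... | inj₁ (h , _) = h
      ... | inj₂ (_ , r∈B) = contradiction (r , x∈p∩q⁺ (r∈A , r∈B)) A₂∩B₂-empty
      B₁⁻ : ∀ {v} → v ∈ X₁ → Adj s v → v ∈ B₁
      B₁⁻ v∈ sv with no-other v∈ s∈ (adj-sym sv)
      ... | inj₁ (_ , s∈A) = contradiction (s , x∈p∩q⁺ (s∈A , proj₂ q∈B×s∈B)) A₂∩B₂-empty
      ... | inj₂ (h , _) = h
      A₂⁻ : ∀ {u} → u ∈ X₂ → Adj p u → u ∈ A₂
      A₂⁻ u∈ pu with no-other p∈ u∈ pu
      ... | inj₁ (_ , h) = h
      ... | inj₂ (p∈B , _) = contradiction (p , x∈p∩q⁺ (p∈A , p∈B)) A₁∩B₁-empty
      B₂⁻ : ∀ {u} → u ∈ X₂ → Adj q u → u ∈ B₂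
      B₂⁻ u∈ qu with no-other q∈ u∈ qu
      ... | inj₁ (q∈A , _) = contradiction (q , x∈p∩q⁺ (q∈A , proj₁ q∈B×s∈B)) A₁∩B₁-empty
      ... | inj₂ (_ , h) = h
      ¬rs : ∀ {v} → v ∈ X₁ → ¬ (Adj r v × Adj s v)
      ¬rs v∈ (rv , sv) = A₁∩B₁-empty (_ , x∈p∩q⁺ (A₁⁻ v∈ rv , B₁⁻ v∈ sv))
      ¬pq : ∀ {u} → u ∈ X₂ → ¬ (Adj p u × Adj q u)
      ¬pq u∈ (pu , qu) = A₂∩B₂-empty (_ , x∈p∩q⁺ (A₂⁻ u∈ pu , B₂⁻ u∈ qu))

      -- This justifies reading the A- and B-sets off the four marked vertices: an adjacent conflict
      -- contradicts `no-other`, a non-adjacent one contradicts completeness.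
      no-conflict : ∀ {v u} → v ∈ X₁ → u ∈ X₂ → ¬ Conflict v u
      no-conflict {v} {u} v∈ u∈ (inj₁ (vu , ≢)) =
        ≢ (code-match⁺ (adj? r v) (adj? s v) (adj? p u) (adj? q u) (¬rs v∈) (¬pq u∈) cross)
        where
        cross : (Adj r v × Adj p u) ⊎ (Adj s v × Adj q u)
        cross with no-other v∈ u∈ vu
        ... | inj₁ (v∈A , u∈A) = inj₁ (adj-sym (A-complete v∈A r∈A) , A-complete p∈A u∈A)
        ... | inj₂ (v∈B , u∈B) = inj₂ (adj-sym (B-complete v∈B (proj₂ q∈B×s∈B))
            , B-complete (proj₁ q∈B×s∈B) u∈B)
      no-conflict {v} {u} v∈ u∈ (inj₂ (¬vu , ≡)) with
        code-match⁻ (adj? r v) (adj? s v) (adj? p u) (adj? q u) (¬rs v∈) ≡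
      ... | inj₁ (rv , pu) = ¬vu (A-complete (A₁⁻ v∈ rv) (A₂⁻ u∈ pu))
      ... | inj₂ (sv , qu) = ¬vu (B-complete (B₁⁻ v∈ sv) (B₂⁻ u∈ qu))

      forced : ∀ {v} → Forced v → v ∈ X₁
      forced seed-p = p∈
      forced seed-q = q∈
      forced seed-c = c∈
      forced (forces {v} {u} f k) with x∈p∪q⁻ X₁ X₂ (covers u)
      ... | inj₁ u∈ = u∈
      ... | inj₂ u∈ = contradiction k (no-conflict (forced f) u∈)

      allowed : ∀ {v} → v ∈ X₁ → Allowed v
      allowed {v} v∈ = cls≢3 , (λ { refl → disjoint (_ , x∈p∩q⁺ (v∈ , r∈)) })
          , (λ { refl → disjoint (_ , x∈p∩q⁺ (v∈ , s∈)) })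
        where
        cls≢3 : cls v ≢ 3
        cls≢3 eq = ¬rs v∈ (code≡3⁻ (adj? r v) (adj? s v) eq)

    -- The necessary half. It refutes all candidates at once, either by a forced vertex that is not
    -- allowed or by a lack of unforced vertices besides `r` and `s`.
    Forced-⊆ : ∀ {X₁ X₂} → Is2Join G X₁ X₂ → p ∈ X₁ → q ∈ X₁ → c ∈ X₁ → r ∈ X₂ → s ∈ X₂ →
               ∀ {v} → Forced v → v ∈ X₁ × Allowed v
    Forced-⊆ J p∈ q∈ c∈ r∈ s∈ f with Is2Join.no-other J p∈ r∈ pr
    ... | inj₁ (p∈A , r∈A) = let v∈ = forced J p∈A r∈A p∈ q∈ c∈ r∈ s∈ f in v∈
        , allowed J p∈A r∈A p∈ q∈ c∈ r∈ s∈ v∈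
    ... | inj₂ (p∈B , r∈B) = let v∈ = forced K p∈B r∈B p∈ q∈ c∈ r∈ s∈ f in v∈
        , allowed K p∈B r∈B p∈ q∈ c∈ r∈ s∈ v∈
      where K = Is2Join-swapAB J

    module _ {X₁ X₂ : Subset n} (split : Separates X₁ X₂)
             (all-allowed : ∀ {v} → Forced v → Allowed v) where

      forced∈ : ∀ {v} → Forced v → v ∈ X₁
      forced∈ {v} f with split v
      ... | inj₁ (_ , h , _) = h
      ... | inj₂ (¬f , _) = contradiction f ¬f

      unforced∈ : ∀ {v} → ¬ Forced v → v ∈ X₂
      unforced∈ {v} ¬f with split v
      ... | inj₁ (f , _) = contradiction f ¬f
      ... | inj₂ (_ , h , _) = h

      forced∈⁻ : ∀ {v} → v ∈ X₁ → Forced v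
      forced∈⁻ {v} v∈ with split v
      ... | inj₁ (f , _) = f
      ... | inj₂ (_ , _ , v∉) = contradiction v∈ v∉

      unforced∈⁻ : ∀ {v} → v ∈ X₂ → ¬ Forced v
      unforced∈⁻ {v} v∈ with split v
      ... | inj₁ (_ , _ , v∉) = contradiction v∈ v∉
      ... | inj₂ (¬f , _) = ¬f

      p∈X₁ : p ∈ X₁
      p∈X₁ = forced∈ seed-p

      q∈X₁ : q ∈ X₁
      q∈X₁ = forced∈ seed-q

      r∈X₂ : r ∈ X₂
      r∈X₂ = unforced∈ λ f → proj₁ (proj₂ (all-allowed f)) refl

      s∈X₂ : s ∈ X₂
      s∈X₂ = unforced∈ λ f → proj₂ (proj₂ (all-allowed f)) refl

      private
        N : Fin n → Subset n
        N x = tabulate λ v → does (adj? x v)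

        N⁺ : ∀ {x v} → Adj x v → v ∈ N x
        N⁺ h = true⇒∈tabulate (dec-true (adj? _ _) h)

        N⁻ : ∀ {x v} → v ∈ N x → Adj x v
        N⁻ {x} {v} h with adj? x v | ∈tabulate⇒true h
        ... | yes e | _ = e

        ¬rs′ : ∀ {v} → v ∈ X₁ → ¬ (Adj r v × Adj s v)
        ¬rs′ v∈ (rv , sv) = proj₁ (all-allowed (forced∈⁻ v∈)) (code≡3⁺ (adj? r _) (adj? s _) rv sv)

        -- `Allowed` says nothing about opp-classes, but such a `u` has opp-class 3 while the
        -- allowed vertex `p` has another class, so the edge `pu` is a conflict and forces `u`.
        ¬pq′ : ∀ {u} → u ∈ X₂ → ¬ (Adj p u × Adj q u)
        ¬pq′ {u} u∈ (pu , qu) = unforced∈⁻ u∈ (forces seed-p (inj₁ (pu , ≢)))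
          where
          ≢ : cls p ≢ opp u
          ≢ eq = proj₁ (all-allowed seed-p) (trans eq (code≡3⁺ (adj? p u) (adj? q u) pu qu))

        cross⇒adj : ∀ {v u} → v ∈ X₁ → u ∈ X₂ → (Adj r v × Adj p u) ⊎ (Adj s v × Adj q u) → Adj v u
        cross⇒adj {v} {u} v∈ u∈ h with adj? v u
        ... | yes vu = vu
        ... | no ¬vu = contradiction (forces (forced∈⁻ v∈) (inj₂ (¬vu ,
                code-match⁺ (adj? r v) (adj? s v) (adj? p u) (adj? q u) (¬rs′ v∈) (¬pq′ u∈) h)))
                    (unforced∈⁻ u∈)

        adj⇒cross : ∀ {v u} → v ∈ X₁ → u ∈ X₂ → Adj v u → (Adj r v × Adj p u) ⊎ (Adj s v × Adj q u)
        adj⇒cross {v} {u} v∈ u∈ vu with cls v ≟ opp u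
        ... | yes eq = code-match⁻ (adj? r v) (adj? s v) (adj? p u) (adj? q u) (¬rs′ v∈) eq
        ... | no neq = contradiction (forces (forced∈⁻ v∈) (inj₁ (vu , neq))) (unforced∈⁻ u∈)

        empty : ∀ {X : Subset n} {x y} → (∀ {v} → v ∈ X → ¬ (Adj x v × Adj y v))
            → Empty ((X ∩ N x) ∩ (X ∩ N y))
        empty {X} {x} {y} h (v , v∈) with x∈p∩q⁻ (X ∩ N x) (X ∩ N y) v∈
        ... | a , b with x∈p∩q⁻ X (N x) a | x∈p∩q⁻ X (N y) b
        ... | v∈X , xv | _ , yv = h v∈X (N⁻ xv , N⁻ yv)

        ∈N : ∀ {X : Subset n} {x v} → v ∈ X → Adj x v → v ∈ X ∩ N x
        ∈N v∈ h = x∈p∩q⁺ (v∈ , N⁺ h)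

        N∋ : ∀ {X : Subset n} {x v} → v ∈ X ∩ N x → v ∈ X × Adj x v
        N∋ {X} {x} h with x∈p∩q⁻ X (N x) h
        ... | v∈ , xv = v∈ , N⁻ xv

      -- The sufficient half. A conflict across the partition would force a vertex of `X₂`, so
      -- adjacency across is exactly agreement of classes. The edges `pr` and `qs` make the four
      -- sets non-empty, and `c` and `x` are the third vertices of the sides.
      Forced-2Join : c ≢ p → c ≢ q → ∀ {x} → ¬ Forced x → x ≢ r → x ≢ s → Is2Join G X₁ X₂
      Forced-2Join c≢p c≢q ¬fx x≢r x≢s = record
        { partition = record { covers = covers ; disjoint = disjoint }
        ; A₁ = X₁ ∩ N r ; B₁ = X₁ ∩ N s ; A₂ = X₂ ∩ N p ; B₂ = X₂ ∩ N q
        ; A₁⊆X₁ = λ h → proj₁ (N∋ h) ; B₁⊆X₁ = λ h → proj₁ (N∋ h)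
        ; A₂⊆X₂ = λ h → proj₁ (N∋ h) ; B₂⊆X₂ = λ h → proj₁ (N∋ h)
        ; A₁-nonempty = p , ∈N p∈X₁ (adj-sym pr) ; B₁-nonempty = q , ∈N q∈X₁ (adj-sym qs)
        ; A₂-nonempty = r , ∈N r∈X₂ pr ; B₂-nonempty = s , ∈N s∈X₂ qs
        ; A₁∩B₁-empty = empty ¬rs′ ; A₂∩B₂-empty = empty ¬pq′
        ; A-complete = complete inj₁ ; B-complete = complete inj₂
        ; no-other = no-other
        ; 3≤∣X₁∣ = 3≤∣p∣ p∈X₁ q∈X₁ (forced∈ seed-c) p≢q (≢-sym c≢p) (≢-sym c≢q)
        ; 3≤∣X₂∣ = 3≤∣p∣ r∈X₂ s∈X₂ (unforced∈ ¬fx) r≢s (≢-sym x≢r) (≢-sym x≢s)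
        }
        where
        covers : ∀ v → v ∈ X₁ ∪ X₂
        covers v with split v
        ... | inj₁ (_ , h , _) = x∈p∪q⁺ (inj₁ h)
        ... | inj₂ (_ , h , _) = x∈p∪q⁺ (inj₂ h)
        disjoint : Empty (X₁ ∩ X₂)
        disjoint (v , h) with x∈p∩q⁻ X₁ X₂ h
        ... | v∈₁ , v∈₂ = unforced∈⁻ v∈₂ (forced∈⁻ v∈₁)
        complete : ∀ {x y} → (∀ {u v} → Adj x u × Adj y v → (Adj r u × Adj p v) ⊎ (Adj s u × Adj q v)) →
                   ∀ {u v} → u ∈ X₁ ∩ N x → v ∈ X₂ ∩ N y → Adj u v
        complete inj hu hv with N∋ hu | N∋ hv
        ... | u∈ , xu | v∈ , yv = cross⇒adj u∈ v∈ (inj (xu , yv))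
        no-other : ∀ {u v} → u ∈ X₁ → v ∈ X₂ → Adj u v →
                   (u ∈ X₁ ∩ N r × v ∈ X₂ ∩ N p) ⊎ (u ∈ X₁ ∩ N s × v ∈ X₂ ∩ N q)
        no-other u∈ v∈ uv with adj⇒cross u∈ v∈ uv
        ... | inj₁ (ru , pv) = inj₁ (∈N u∈ ru , ∈N v∈ pv)
        ... | inj₂ (su , qv) = inj₂ (∈N u∈ su , ∈N v∈ qv)

-- Building blocks of the algorithm

forNbrs : ℕ → Program → Program
forNbrs w P = rI ≔ 0 [ var w ] ⨾ rE ≔ 0 [ inc (var w) ] ⨾
              while (var rI << var rE) (rU ≔ 1 [ var rI ] ⨾ P ⨾ rI ≔ inc (var rI))

module _ {n : ℕ} {G : Graph n} (L : AdjacencyLists G) where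
  open AdjacencyLists L

  deg : Fin n → ℕ
  deg v = length (nbrs v)

  record Input (s : State) : Set where
    field
      size  : vars s 0 ≡ n
      start : ∀ v → Segment (arrs s 1) (arrs s 0 (toℕ v)) (nbrs v)
      stop  : ∀ v → arrs s 0 (suc (toℕ v)) ≡ arrs s 0 (toℕ v) + deg v
  open Input

  Input-resp : ∀ {P s s′} → writesVar P 0 ≡ false → writesArr P 0 ≡ false → writesArr P 1 ≡ false →
               Unchanged P s s′ → Input s → Input s′
  Input-resp w0 a0 a1 u I = record
    { size  = trans (var≡ u 0 w0) (size I)
    ; start = λ v → subst₂ (λ f g → Segment f (g (toℕ v)) (nbrs v)) (sym (arr≡ u 1 a1))
        (sym (arr≡ u 0 a0)) (start I v)
    ; stop  = λ v → subst (λ g → g (suc (toℕ v)) ≡ g (toℕ v) + deg v) (sym (arr≡ u 0 a0)) (stop I v)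
    }

  -- The invariant is indexed by the part of the list still to be scanned, which makes the rule
  -- independent of the order of the neighbours.
  forNbrs-rule : ∀ P w v {s₀} (Inv : List (Fin n) → State → Set) →
    writesVar P rI ≡ false → writesVar P rE ≡ false → writesArr P 1 ≡ false → (w ≡ᵇ rI) ≡ false →
    (∀ {xs s i} → Inv xs s → Inv xs (setVar s rI i)) →
    (∀ {xs s i} → Inv xs s → Inv xs (setVar s rE i)) →
    (∀ {xs s i} → Inv xs s → Inv xs (setVar s rU i)) →
    (∀ {x xs s} → x ∈ᴸ nbrs v → Unchanged (forNbrs w P) s₀ s → vars s rU ≡ toℕ x →
     Inv (x ∷ xs) s → wp P (Inv xs) s) →
    Input s₀ → vars s₀ w ≡ toℕ v → Inv (nbrs v) s₀ →
    Runs (forNbrs w P) s₀ ((10 + bound P) * suc (deg v)) (Inv [])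
  forNbrs-rule P w v {s₀} Inv wI wE a1 w≢ stI stE stU step I w≡ inv0 =
    Runs-mono le (λ _ q → q)
      (Runs-⨾ (Runs-wp (rI ≔ 0 [ var w ]) {Q = λ s → s ≡ s₁} refl)
        λ { {s} u refl → Runs-⨾ (Runs-wp (rE ≔ 0 [ inc (var w) ]) {Q = λ s → s ≡ s₂} refl)
          λ { {s} u′ refl → go (nbrs v) id
                (Unchanged-trans (writes-⨾ˡ {Q = rest} u)
                   (writes-⨾ʳ {P = rI ≔ 0 [ var w ]} (writes-⨾ˡ {Q = loop} u′)))
                 (subst (λ j → Segment (arrs s₀ 1) (arrs s₀ 0 j) (nbrs v)) (sym w≡) (start I v))
                 end≡ (stE (stI inv0)) } })
    where
    body = rU ≔ 1 [ var rI ] ⨾ P ⨾ rI ≔ inc (var rI)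
    loop = while (var rI << var rE) body
    rest = rE ≔ 0 [ inc (var w) ] ⨾ loop
    s₁ = setVar s₀ rI (arrs s₀ 0 (vars s₀ w))
    s₂ = setVar s₁ rE (arrs s₀ 0 (suc (vars s₁ w)))
    -- A round costs nine steps besides `P`. The tenth lets the extra round in `suc (deg v)` cover
    -- the two initial assignments and the final test, 3 + 4 + 3 steps.
    κ = 10 + bound P
    open ≤-Reasoning hiding (start; stop)
    -- Register `w` is read a second time after `rI` has been overwritten, so the two must differ.
    w₁≡ : vars s₁ w ≡ toℕ v
    w₁≡ = trans (cong (λ b → if b then arrs s₀ 0 (vars s₀ w) else vars s₀ w) w≢) w≡
    end≡ : arrs s₀ 0 (vars s₀ w) + deg v ≡ arrs s₀ 0 (suc (vars s₁ w))
    end≡ = trans (cong (λ j → arrs s₀ 0 j + deg v) w≡)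
             (trans (sym (stop I v)) (cong (λ j → arrs s₀ 0 (suc j)) (sym w₁≡)))

    go : ∀ xs {s} → (∀ {x} → x ∈ᴸ xs → x ∈ᴸ nbrs v) → Unchanged (forNbrs w P) s₀ s →
         Segment (arrs s 1) (vars s rI) xs → vars s rI + length xs ≡ vars s rE → Inv xs s →
         Runs loop s (κ * length xs + 3) (Inv [])
    go [] {s} sub u seg eE inv =
      while-stop (≤-reflexive (trans (sym eE) (+-identityʳ _))) (m≤n+m 3 _) inv
    go (x ∷ xs) {s} sub u (x≡ ∷ seg) eE inv =
      Runs-mono le′ (λ _ q → q)
        (while-unfold (subst (vars s rI <_) eE (m<m+n _ (s≤s z≤n)))
          (Runs-⨾ (Runs-wp (rU ≔ 1 [ var rI ]) {Q = λ s′ → s′ ≡ setVar s rU (arrs s 1 (vars s rI))} refl)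
            λ { {s₃} u₃ refl → Runs-⨾ (Runs-wp P
                (step (sub (here refl)) (Unchanged-trans u
                    (lift (writes-⨾ˡ {Q = P ⨾ rI ≔ inc (var rI)} u₃))) x≡ (stU inv)))
              λ u′ q → Runs-wp (rI ≔ inc (var rI))
                {Q = λ s′ → Inv xs s′ × vars s′ rI ≡ suc (vars s rI)}
                (stI q , cong suc (var≡ u′ rI wI)) })
          λ { {s′} u′ (q , e) → go xs (sub ∘ there)
                (Unchanged-trans u (lift u′))
                (subst₂ (λ f l → Segment f l xs) (sym (arr≡ u′ 1 (cong (_∨ false) a1))) (sym e) seg)
                (trans (trans (cong (_+ length xs) e) (sym (+-suc (vars s rI) (length xs))))
                       (trans eE (sym (var≡ u′ rE (cong (_∨ false) wE)))))
                q })
      where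
      lift : ∀ {s s′} → Unchanged body s s′ → Unchanged (forNbrs w P) s s′
      lift u′ = writes-⨾ʳ {P = rI ≔ 0 [ var w ]}
          (writes-⨾ʳ {P = rE ≔ 0 [ inc (var w) ]} (unchanged (var≡ u′) (arr≡ u′)))
      le′ : 3 + (3 + (bound P + 3)) + (κ * length xs + 3) ≤ κ * suc (length xs) + 3
      le′ = begin
        3 + (3 + (bound P + 3)) + (κ * length xs + 3)  ≡⟨ +-assoc (6 + (bound P + 3)) (κ * length xs) 3 ⟨
        6 + (bound P + 3) + κ * length xs + 3          ≡⟨ cong (λ z → 6 + z + κ * length xs + 3)
            (+-comm (bound P) 3) ⟩
        9 + bound P + κ * length xs + 3                ≤⟨ +-monoˡ-≤ 3
            (+-monoˡ-≤ (κ * length xs) (n≤1+n (9 + bound P))) ⟩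
        κ + κ * length xs + 3                          ≡⟨ cong (_+ 3) (*-suc κ (length xs)) ⟨
        κ * suc (length xs) + 3                        ∎
    le : 3 + (4 + (κ * deg v + 3)) ≤ κ * suc (deg v)
    le = begin
      7 + (κ * deg v + 3)      ≡⟨ cong (7 +_) (+-comm (κ * deg v) 3) ⟩
      10 + κ * deg v           ≤⟨ +-monoˡ-≤ (κ * deg v) (m≤m+n 10 (bound P)) ⟩
      κ + κ * deg v            ≡⟨ *-suc κ (deg v) ⟨
      κ * suc (deg v)          ∎

-- Array cells, flag arrays and linear searches

update-cases : ∀ {X : Set} (f : ℕ → X) i {x} j → (j ≡ i × update f i x j ≡ x)
    ⊎ (j ≢ i × update f i x j ≡ f j)
update-cases f i j with j ≟ i
... | yes refl = inj₁ (refl , update-same f i)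
... | no  j≢i  = inj₂ (j≢i , update-other f j≢i)

setArr-same : ∀ s A i k → arrs (setArr s A i k) A ≡ update (arrs s A) i k
setArr-same s A i k = update-same (arrs s) A

-- The array carries a decision of `R`, which for `Forced` is available only once the exploration
-- has ended.
record Flags {n : ℕ} (f : ℕ → ℕ) (R : Fin n → Set) : Set where
  constructor flags
  field
    flag : ∀ u → (R u × f (toℕ u) ≡ 1) ⊎ (¬ R u × f (toℕ u) ≡ 0)
open Flags

Flags-yes : ∀ {n f} {R : Fin n → Set} → Flags f R → ∀ u → f (toℕ u) ≡ 1 → R u
Flags-yes F u h with flag F u
... | inj₁ (r , _) = r
... | inj₂ (_ , h′) = case trans (sym h) h′ of λ ()

Flags-no : ∀ {n f} {R : Fin n → Set} → Flags f R → ∀ u → f (toℕ u) ≢ 1 → ¬ R u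
Flags-no F u h with flag F u
... | inj₁ (_ , h′) = contradiction h′ h
... | inj₂ (¬r , _) = ¬r

-- Memory is 0 at the outset, but the run with exchanged sides finds the arrays filled by the first
-- run.
clear : ℕ → Program
clear A = forRange (A [ var rI ]≔ lit 0)

clear-rule : ∀ A {n s} → vars s 0 ≡ n →
             Runs (clear A) s (9 * suc n) λ s′ → ∀ (u : Fin n) → arrs s′ A (toℕ u) ≡ 0
clear-rule A {n} {s} n≡ = Runs-mono ≤-refl (λ _ h u → h u (toℕ<n u))
  (forRange-rule (A [ var rI ]≔ lit 0) (λ k s → ∀ (u : Fin n) → toℕ u < k → arrs s A (toℕ u) ≡ 0)
    refl refl id step n≡ (λ _ ()))
  where
  step : ∀ {s′} (i : Fin n) → Unchanged (clear A) s s′ → vars s′ rI ≡ toℕ i →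
         (∀ (u : Fin n) → toℕ u < toℕ i → arrs s′ A (toℕ u) ≡ 0) →
         ∀ (u : Fin n) → toℕ u < suc (toℕ i) → arrs (setArr s′ A (vars s′ rI) 0) A (toℕ u) ≡ 0
  step {s′} i _ i≡ h u u< rewrite setArr-same s′ A (vars s′ rI) 0 | i≡ with update-cases
      (arrs s′ A) (toℕ i) {0} (toℕ u)
  ... | inj₁ (_ , eq) = eq
  ... | inj₂ (u≢i , eq) = trans eq (h u (≤∧≢⇒< (≤-pred u<) u≢i))

classify : ℕ → ℕ → ℕ → ℕ → Program
classify C A B d = forRange
  (cond (A [ var rI ] == lit 1)
    (cond (B [ var rI ] == lit 1) (C [ var rI ]≔ lit 3) (C [ var rI ]≔ lit 1))
    (cond (B [ var rI ] == lit 1) (C [ var rI ]≔ lit 2) (C [ var rI ]≔ lit d)))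

classify-rule : ∀ C A B d {n s} {R S : Fin n → Set} (R? : ∀ u → Dec (R u)) (S? : ∀ u → Dec (S u)) →
  (A ≡ᵇ C) ≡ false → (B ≡ᵇ C) ≡ false → vars s 0 ≡ n → Flags (arrs s A) R → Flags (arrs s B) S →
  Runs (classify C A B d) s (30 * suc n) λ s′ → ∀ u → arrs s′ C (toℕ u) ≡ code d (R? u) (S? u)
classify-rule C A B d {n} {s} {R} {S} R? S? A≢ B≢ n≡ FA FB =
  Runs-mono ≤-refl′ (λ _ h u → h u (toℕ<n u))
  (forRange-rule body Inv refl refl id step n≡ (λ _ ()))
  where
  body : Program
  body = cond (A [ var rI ] == lit 1)
    (cond (B [ var rI ] == lit 1) (C [ var rI ]≔ lit 3) (C [ var rI ]≔ lit 1))
    (cond (B [ var rI ] == lit 1) (C [ var rI ]≔ lit 2) (C [ var rI ]≔ lit d))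
  ≤-refl′ : (6 + bound body) * suc n ≤ 30 * suc n
  ≤-refl′ = *-monoˡ-≤ (suc n) (≤ᵇ⇒≤ (6 + bound body) 30 _)
  Inv : ℕ → State → Set
  Inv k s′ = ∀ u → toℕ u < k → arrs s′ C (toℕ u) ≡ code d (R? u) (S? u)
  store : ∀ {s′} (i : Fin n) k → vars s′ rI ≡ toℕ i → Inv (toℕ i) s′ → k ≡ code d (R? i) (S? i) →
          Inv (suc (toℕ i)) (setArr s′ C (vars s′ rI) k)
  store {s′} i k i≡ h eq u u< rewrite setArr-same s′ C (vars s′ rI) k | i≡ with update-cases
      (arrs s′ C) (toℕ i) {k} (toℕ u)
  ... | inj₁ (u≡i , eq′) rewrite toℕ-injective u≡i = trans eq′ eq
  ... | inj₂ (u≢i , eq′) = trans eq′ (h u (≤∧≢⇒< (≤-pred u<) u≢i))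
  code-yy : ∀ u → R u → S u → code d (R? u) (S? u) ≡ 3
  code-yy u r s with R? u | S? u
  ... | yes _ | yes _ = refl
  ... | no ¬r | _ = contradiction r ¬r
  ... | yes _ | no ¬s = contradiction s ¬s
  code-yn : ∀ u → R u → ¬ S u → code d (R? u) (S? u) ≡ 1
  code-yn u r ¬s with R? u | S? u
  ... | yes _ | no _ = refl
  ... | no ¬r | _ = contradiction r ¬r
  ... | yes _ | yes s = contradiction s ¬s
  code-ny : ∀ u → ¬ R u → S u → code d (R? u) (S? u) ≡ 2
  code-ny u ¬r s with R? u | S? u
  ... | no _ | yes _ = refl
  ... | yes r | _ = contradiction r ¬r
  ... | no _ | no ¬s = contradiction s ¬s
  code-nn : ∀ u → ¬ R u → ¬ S u → code d (R? u) (S? u) ≡ d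
  code-nn u ¬r ¬s with R? u | S? u
  ... | no _ | no _ = refl
  ... | yes r | _ = contradiction r ¬r
  ... | no _ | yes s = contradiction s ¬s
  step : ∀ {s′} (i : Fin n) → Unchanged (classify C A B d) s s′ → vars s′ rI ≡ toℕ i →
         Inv (toℕ i) s′ → wp body (Inv (suc (toℕ i))) s′
  step {s′} i u i≡ h =
      (λ a → (λ b → store {s′} i 3 i≡ h (sym (code-yy i (Ry a) (Sy b))))
           , (λ b → store {s′} i 1 i≡ h (sym (code-yn i (Ry a) (Sn b)))))
    , (λ a → (λ b → store {s′} i 2 i≡ h (sym (code-ny i (Rn a) (Sy b))))
           , (λ b → store {s′} i d i≡ h (sym (code-nn i (Rn a) (Sn b)))))
    where
    unwritten : ∀ D → (D ≡ᵇ C) ≡ false → writesArr (classify C A B d) D ≡ false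
    unwritten D h rewrite h = refl
    FA′ : Flags (arrs s′ A) R
    FA′ = subst (λ f → Flags f R) (sym (arr≡ u A (unwritten A A≢))) FA
    FB′ : Flags (arrs s′ B) S
    FB′ = subst (λ f → Flags f S) (sym (arr≡ u B (unwritten B B≢))) FB
    Ry : arrs s′ A (vars s′ rI) ≡ 1 → R i
    Ry h = Flags-yes FA′ i (trans (cong (arrs s′ A) (sym i≡)) h)
    Rn : arrs s′ A (vars s′ rI) ≢ 1 → ¬ R i
    Rn h = Flags-no FA′ i (h ∘ trans (cong (arrs s′ A) i≡))
    Sy : arrs s′ B (vars s′ rI) ≡ 1 → S i
    Sy h = Flags-yes FB′ i (trans (cong (arrs s′ B) (sym i≡)) h)
    Sn : arrs s′ B (vars s′ rI) ≢ 1 → ¬ S i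
    Sn h = Flags-no FB′ i (h ∘ trans (cong (arrs s′ B) i≡))

rFound : ℕ
rFound = 19

-- The index found is stored plus one, which leaves 0 for failure. There is no early exit, so the
-- last hit is kept.
search : Test → Program
search b = rFound ≔ lit 0 ⨾ forRange (cond b (rFound ≔ inc (var rI)) skip)

SearchResult : ∀ {n} → (Fin n → Set) → State → Set
SearchResult R s = (∃[ i ] (vars s rFound ≡ suc (toℕ i) × R i)) ⊎ (vars s rFound ≡ 0 × ∀ i → ¬ R i)

search-rule : ∀ b {n s} (R : Fin n → Set) →
  (∀ {s′} (i : Fin n) → Unchanged (search b) s s′ → vars s′ rI ≡ toℕ i →
   (Holds s′ b → R i) × (Fails s′ b → ¬ R i)) →
  vars s 0 ≡ n →
  Runs (search b) s ((12 + costᵀ b) * suc n) (SearchResult R)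
search-rule b {n} {s} R decide n≡ =
  Runs-mono le (λ _ → λ { (inj₁ f) → inj₁ f ; (inj₂ (z , h)) → inj₂ (z , λ i → h i (toℕ<n i)) })
    (Runs-⨾ (Runs-wp (rFound ≔ lit 0) {Q = λ s′ → s′ ≡ setVar s rFound 0} refl)
      λ { u refl → forRange-rule body Inv refl refl id (λ i u′ → step i (Unchanged-trans
              (writes-⨾ˡ {Q = forRange body} u) (writes-⨾ʳ {P = rFound ≔ lit 0} u′)))
            n≡ (inj₂ (refl , λ _ ())) })
  where
  body : Program
  body = cond b (rFound ≔ inc (var rI)) skip
  Inv : ℕ → State → Set
  Inv k s′ = (∃[ i ] (vars s′ rFound ≡ suc (toℕ i) × R i)) ⊎ (vars s′ rFound ≡ 0 × ∀ i → toℕ i < k → ¬ R i)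
  step : ∀ {s′} (i : Fin n) → Unchanged (search b) s s′ → vars s′ rI ≡ toℕ i →
         Inv (toℕ i) s′ → wp body (Inv (suc (toℕ i))) s′
  step {s′} i u i≡ inv = (λ h → inj₁ (i , cong suc i≡ , proj₁ (decide i u i≡) h)) , miss inv
    where
    miss : Inv (toℕ i) s′ → Fails s′ b → Inv (suc (toℕ i)) s′
    miss (inj₁ f) h = inj₁ f
    miss (inj₂ (z , none)) h = inj₂ (z , λ j j< → case m≤n⇒m<n∨m≡n (≤-pred j<) of λ
      { (inj₁ j<i) → none j j<i
      ; (inj₂ j≡i) r → proj₂ (decide i u i≡) h (subst R (toℕ-injective j≡i) r) })
  open ≤-Reasoning
  le : 2 + (6 + (costᵀ b + 4)) * suc n ≤ (12 + costᵀ b) * suc n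
  le = begin
    2 + (6 + (costᵀ b + 4)) * suc n         ≤⟨ +-monoˡ-≤ ((6 + (costᵀ b + 4)) * suc n) (m≤m*n 2 (suc n)) ⟩
    2 * suc n + (6 + (costᵀ b + 4)) * suc n ≡⟨ *-distribʳ-+ (suc n) 2 (6 + (costᵀ b + 4)) ⟨
    (8 + (costᵀ b + 4)) * suc n             ≡⟨ cong (λ z → (8 + z) * suc n) (+-comm (costᵀ b) 4) ⟩
    (12 + costᵀ b) * suc n                  ∎

-- Marking neighbours and pushing conflicts

rMark rLen rV rK rW : ℕ
rMark = 14
rLen  = 15
rV    = 16
rK    = 17
rW    = 18

-- With `rMark` equal to 1 this fills a flag array; with `rMark` equal to v + 1 it stamps the
-- neighbours of v, and stamps of earlier vertices may stay.
mark : ℕ → ℕ → Program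
mark A w = forNbrs w (A [ var rU ]≔ var rMark)

-- The head of the list is the top, in the cell just below `l`. Cells from `l` on are unconstrained,
-- so that popping is a mere decrement.
data Stack {n : ℕ} (f : ℕ → ℕ) : ℕ → List (Fin n) → Set where
  []  : Stack f 0 []
  _∷_ : ∀ {l x xs} → f l ≡ toℕ x → Stack f l xs → Stack f (suc l) (x ∷ xs)

Stack-update : ∀ {n f l k m} {xs : List (Fin n)} → l ≤ k → Stack f l xs → Stack (update f k m) l xs
Stack-update l≤k [] = []
Stack-update {f = f} {suc l} {k} {m} l<k (eq ∷ st) =
  trans (update-other f (<⇒≢ l<k)) eq ∷ Stack-update (<⇒≤ l<k) st

aOpp aStamp aStack : ℕ
aOpp   = 7
aStamp = 10
aStack = 12

-- A vertex may occur on the stack several times: duplicates are discarded when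
-- they are popped.
push : Program
push = aStack [ var rLen ]≔ var rU ⨾ rLen ≔ inc (var rLen)

pushConflict : Program
pushConflict = cond (aStamp [ var rU ] == var rMark)
                 (cond (var rK == aOpp [ var rU ]) skip push)
                 (cond (var rK == aOpp [ var rU ]) push skip)

pushConflicts : ℕ → Program
pushConflicts w = forNbrs w pushConflict

module _ {n : ℕ} {G : Graph n} (L : AdjacencyLists G) where
  open Graph G
  open AdjacencyLists L

  mark-rule : ∀ A w v {s} → (1 ≡ᵇ A) ≡ false → (w ≡ᵇ rI) ≡ false → Input L s → vars s w ≡ toℕ v →
    Runs (mark A w) s (13 * suc (deg L v)) λ s′ → ∀ u →
      (Adj v u × arrs s′ A (toℕ u) ≡ vars s rMark) ⊎ (¬ Adj v u × arrs s′ A (toℕ u) ≡ arrs s A (toℕ u))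
  mark-rule A w v {s} A≢1 w≢ I w≡ = Runs-mono ≤-refl (λ {s′} _ inv u → final {s′} (inv u))
    (forNbrs-rule L (A [ var rU ]≔ var rMark) w v Inv refl refl A≢1 w≢ id id id step I w≡
      (λ u → inj₂ (refl , id)))
    where
    Inv : List (Fin n) → State → Set
    Inv xs s′ = ∀ u → (u ∈ᴸ nbrs v × arrs s′ A (toℕ u) ≡ vars s rMark)
                    ⊎ (arrs s′ A (toℕ u) ≡ arrs s A (toℕ u) × (u ∈ᴸ nbrs v → u ∈ᴸ xs))
    step : ∀ {x xs s′} → x ∈ᴸ nbrs v → Unchanged (mark A w) s s′ → vars s′ rU ≡ toℕ x →
           Inv (x ∷ xs) s′ → Inv xs (setArr s′ A (vars s′ rU) (vars s′ rMark))
    step {x} {xs} {s′} x∈ un x≡ inv u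
      rewrite setArr-same s′ A (vars s′ rU) (vars s′ rMark) | x≡
      with update-cases (arrs s′ A) (toℕ x) {vars s′ rMark} (toℕ u)
    ... | inj₁ (u≡x , eq) rewrite toℕ-injective u≡x = inj₁ (x∈ , trans eq (var≡ un rMark refl))
    ... | inj₂ (u≢x , eq) with inv u
    ...   | inj₁ (u∈ , eq′) = inj₁ (u∈ , trans eq eq′)
    ...   | inj₂ (eq′ , todo) = inj₂ (trans eq eq′ , λ u∈ → case todo u∈ of λ
            { (here u≡x) → contradiction (cong toℕ u≡x) u≢x ; (there u∈xs) → u∈xs })
    final : ∀ {s′ u} → (u ∈ᴸ nbrs v × arrs s′ A (toℕ u) ≡ vars s rMark)
                    ⊎ (arrs s′ A (toℕ u) ≡ arrs s A (toℕ u) × (u ∈ᴸ nbrs v → u ∈ᴸ [])) →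
            (Adj v u × arrs s′ A (toℕ u) ≡ vars s rMark)
                ⊎ (¬ Adj v u × arrs s′ A (toℕ u) ≡ arrs s A (toℕ u))
    final {u = u} (inj₁ (u∈ , eq)) = inj₁ (Equivalence.to (nbrs-adj v u) u∈ , eq)
    final {u = u} (inj₂ (eq , todo)) = inj₂
        ((λ vu → case todo (Equivalence.from (nbrs-adj v u) vu) of λ ()) , eq)

  module _ (p q r s c : Fin n) where

    -- The list scanned is that of `x`, the conflicts sought are those of `v`: `x` is `v` itself for
    -- adjacent conflicts and the reference vertex for non-adjacent ones.
    pushConflicts-rule : ∀ w v x {σ st} → (w ≡ᵇ rI) ≡ false → Input L σ → vars σ w ≡ toℕ x →
      (∀ u → (Adj v u × arrs σ aStamp (toℕ u) ≡ vars σ rMark)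
          ⊎ (¬ Adj v u × arrs σ aStamp (toℕ u) ≢ vars σ rMark)) →
      vars σ rK ≡ cls G p q r s c v → (∀ u → arrs σ aOpp (toℕ u) ≡ opp G p q r s c u) →
      Stack (arrs σ aStack) (vars σ rLen) st →
      Runs (pushConflicts w) σ (60 * suc (deg L x)) λ σ′ →
        ∃[ new ] (Stack (arrs σ′ aStack) (vars σ′ rLen) (new ++ st)
                 × length new ≤ deg L x
                 × (∀ {u} → u ∈ᴸ new → Conflict G p q r s c v u)
                 × (∀ {u} → Adj x u → Conflict G p q r s c v u → u ∈ᴸ new))
    pushConflicts-rule w v x {σ} {st} w≢ I w≡ stamps k≡ opps stk =
      Runs-mono (*-monoˡ-≤ (suc (deg L x)) (≤ᵇ⇒≤ (10 + bound pushConflict) 60 _))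
        (λ {σ′} _ → final {σ′})
        (forNbrs-rule L pushConflict w x Inv refl refl refl w≢ id id id step I w≡
          ([] , stk , ≤-refl , (λ ()) , λ u∈ _ → inj₂ u∈))
      where
      Conf : Fin n → Set
      Conf = Conflict G p q r s c v
      Inv : List (Fin n) → State → Set
      Inv xs σ′ = ∃[ new ] (Stack (arrs σ′ aStack) (vars σ′ rLen) (new ++ st)
                 × length new + length xs ≤ deg L x
                 × (∀ {u} → u ∈ᴸ new → Conf u)
                 × (∀ {u} → u ∈ᴸ nbrs x → Conf u → u ∈ᴸ new ⊎ u ∈ᴸ xs))
      final : ∀ {σ′} → Inv [] σ′ → ∃[ new ] (Stack (arrs σ′ aStack) (vars σ′ rLen) (new ++ st)
                 × length new ≤ deg L x × (∀ {u} → u ∈ᴸ new → Conf u)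
                     × (∀ {u} → Adj x u → Conf u → u ∈ᴸ new))
      final (new , stk′ , len , snd , cmp) =
        new , stk′ , ≤-trans (≤-reflexive (sym (+-identityʳ _))) len , snd ,
        λ {u} xu cf → case cmp (Equivalence.from (nbrs-adj x u) xu) cf of λ { (inj₁ h) → h ; (inj₂ ()) }
      step : ∀ {y xs σ′} → y ∈ᴸ nbrs x → Unchanged (pushConflicts w) σ σ′ → vars σ′ rU ≡ toℕ y →
             Inv (y ∷ xs) σ′ → wp pushConflict (Inv xs) σ′
      step {y} {xs} {σ′} y∈ un y≡ (new , stk′ , len , snd , cmp) =
          (λ adj → (λ eq → skipped λ { (inj₁ (_ , ≢)) → ≢ (mt eq) ; (inj₂ (¬a , _)) → ¬a (adjacent adj) })
                 , (λ ≢ → pushed (inj₁ (adjacent adj , λ eq → ≢ (mt⁻ eq)))))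
        , (λ nadj → (λ eq → pushed (inj₂ (nonadjacent nadj , mt eq)))
                  , (λ ≢ → skipped λ { (inj₁ (a , _)) → nonadjacent nadj a ; (inj₂ (_ , eq))
                      → ≢ (mt⁻ eq) }))
        where
        stamp≡ : arrs σ′ aStamp (vars σ′ rU) ≡ arrs σ aStamp (toℕ y)
        stamp≡ = trans (cong (arrs σ′ aStamp) y≡) (cong (λ f → f (toℕ y)) (arr≡ un aStamp refl))
        adjacent : arrs σ′ aStamp (vars σ′ rU) ≡ vars σ′ rMark → Adj v y
        adjacent h with stamps y
        ... | inj₁ (a , _) = a
        ... | inj₂ (_ , ≢) = contradiction (trans (sym stamp≡) (trans h (var≡ un rMark refl))) ≢
        nonadjacent : arrs σ′ aStamp (vars σ′ rU) ≢ vars σ′ rMark → ¬ Adj v y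
        nonadjacent h with stamps y
        ... | inj₁ (_ , eq) = contradiction (trans stamp≡ (trans eq (sym (var≡ un rMark refl)))) h
        ... | inj₂ (¬a , _) = ¬a
        rK≡ : vars σ′ rK ≡ cls G p q r s c v
        rK≡ = trans (var≡ un rK refl) k≡
        opp≡ : arrs σ′ aOpp (vars σ′ rU) ≡ opp G p q r s c y
        opp≡ = trans (cong (arrs σ′ aOpp) y≡) (trans (cong (λ f → f (toℕ y)) (arr≡ un aOpp refl)) (opps y))
        mt : vars σ′ rK ≡ arrs σ′ aOpp (vars σ′ rU) → cls G p q r s c v ≡ opp G p q r s c y
        mt eq = trans (sym rK≡) (trans eq opp≡)
        mt⁻ : cls G p q r s c v ≡ opp G p q r s c y → vars σ′ rK ≡ arrs σ′ aOpp (vars σ′ rU)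
        mt⁻ eq = trans rK≡ (trans eq (sym opp≡))
        len′ : suc (length new + length xs) ≤ deg L x
        len′ = ≤-trans (≤-reflexive (sym (+-suc _ _))) len
        skipped : ¬ Conf y → Inv xs σ′
        skipped ¬cf = new , stk′ , <⇒≤ len′ , snd , λ u∈ cf → case cmp u∈ cf of λ
          { (inj₁ h) → inj₁ h ; (inj₂ (here refl)) → contradiction cf ¬cf ; (inj₂ (there h)) → inj₂ h }
        pushed : Conf y → wp push (Inv xs) σ′
        pushed cf = y ∷ new
          , trans (update-same (arrs σ′ aStack) (vars σ′ rLen)) y≡ ∷ Stack-update ≤-refl stk′
          , len′
          , (λ { (here refl) → cf ; (there h) → snd h })
          , λ u∈ cf′ → case cmp u∈ cf′ of λ
              { (inj₁ h) → inj₁ (there h) ; (inj₂ (here refl)) → inj₁ (here refl)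
                  ; (inj₂ (there h)) → inj₂ h }

-- Exploring the forced vertices

sum-mono : ∀ {m} {f g : Fin m → ℕ} → (∀ j → g j ≤ f j) → sum g ≤ sum f
sum-mono {zero} h = z≤n
sum-mono {suc m} h = +-mono-≤ (h Fin.zero) (sum-mono (h ∘ Fin.suc))

-- Amortisation without subtraction: what is paid or refunded at the single summand `i` appears as
-- `x` and `y` on the two sides.
sum-exchange : ∀ {m} {f g : Fin m → ℕ} i {x y} → (∀ j → j ≢ i → g j ≤ f j) → g i + x ≤ f i + y →
               sum g + x ≤ sum f + y
sum-exchange {suc m} {f} {g} Fin.zero {x} {y} h hi = begin
  g Fin.zero + sum (g ∘ Fin.suc) + x   ≡⟨ assoc₁ (g Fin.zero) (sum (g ∘ Fin.suc)) x ⟩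
  g Fin.zero + x + sum (g ∘ Fin.suc)   ≤⟨ +-mono-≤ hi (sum-mono (λ j → h (Fin.suc j) λ ())) ⟩
  f Fin.zero + y + sum (f ∘ Fin.suc)   ≡⟨ assoc₁ (f Fin.zero) (sum (f ∘ Fin.suc)) y ⟨
  f Fin.zero + sum (f ∘ Fin.suc) + y   ∎
  where
  open ≤-Reasoning
  open +-*-Solver
  assoc₁ : ∀ a b c → a + b + c ≡ a + c + b
  assoc₁ = solve 3 (λ a b c → a :+ b :+ c := a :+ c :+ b) refl
sum-exchange {suc m} {f} {g} (Fin.suc i) {x} {y} h hi = begin
  g Fin.zero + sum (g ∘ Fin.suc) + x   ≡⟨ +-assoc (g Fin.zero) _ x ⟩
  g Fin.zero + (sum (g ∘ Fin.suc) + x)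
      ≤⟨ +-mono-≤ (h Fin.zero λ ()) (sum-exchange i (λ j j≢ → h (Fin.suc j) (j≢ ∘ Fin-suc-injective)) hi) ⟩
  f Fin.zero + (sum (f ∘ Fin.suc) + y) ≡⟨ +-assoc (f Fin.zero) _ y ⟨
  f Fin.zero + sum (f ∘ Fin.suc) + y   ∎
  where
  open ≤-Reasoning

-- A record, so that `X` and `K` can be recovered by unification. Coefficients add up along `_⊕_`,
-- and each cost estimate shrinks to a comparison of closed numerals.
record Within (X K a : ℕ) : Set where
  constructor within
  field
    ≤* : a ≤ K * X
open Within

infixr 6 _⊕_
_⊕_ : ∀ {X K M a b} → Within X K a → Within X M b → Within X (K + M) (a + b)
≤* (_⊕_ {X} {K} {M} (within h) (within k)) =
  ≤-trans (+-mono-≤ h k) (≤-reflexive (sym (*-distribʳ-+ X K M)))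

const-within : ∀ a {x} → Within (suc x) a a
const-within a {x} = within (m≤m*n a (suc x))

scale-within : ∀ a {x X} → x ≤ X → Within X a (a * x)
scale-within a h = within (*-monoʳ-≤ a h)

within-≤ : ∀ {X K M a} → K ≤ M → Within X K a → a ≤ M * X
within-≤ {X} K≤M (within h) = ≤-trans h (*-monoˡ-≤ X K≤M)

aCls aDone aRef rp rq rr rs rc : ℕ
aCls  = 8
aDone = 9
aRef  = 11
rp    = 6
rq    = 7
rr    = 8
rs    = 9
rc    = 10

pop enter process : Program
pop = rLen ≔ dec (var rLen) ⨾ rV ≔ aStack [ var rLen ]
enter = aDone [ var rV ]≔ lit 1 ⨾ rMark ≔ inc (var rV) ⨾ rK ≔ aCls [ var rV ] ⨾ rW ≔ aRef [ var rK ]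
process = mark aStamp rV ⨾ pushConflicts rV ⨾ pushConflicts rW ⨾ aRef [ var rK ]≔ var rV

explore : Program
explore = while (lit 0 << var rLen)
  (pop ⨾ cond (aDone [ var rV ] == lit 1) skip (enter ⨾ process))

Stack-pop : ∀ {n f l x} {xs : List (Fin n)} → Stack f l (x ∷ xs) →
            f (pred l) ≡ toℕ x × Stack f (pred l) xs
Stack-pop (eq ∷ st) = eq , st

Stack-nonempty : ∀ {n f l} {xs : List (Fin n)} → 0 < l → Stack f l xs → ∃[ y ] ∃[ ys ] xs ≡ y ∷ ys
Stack-nonempty () []
Stack-nonempty _ (_ ∷ _) = _ , _ , refl

Stack-empty : ∀ {n f l} {xs : List (Fin n)} → l ≤ 0 → Stack f l xs → xs ≡ []
Stack-empty _ [] = refl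
Stack-empty () (_ ∷ _)

-- Steps per unit of potential, rounded up from the sum of the constants in one iteration of
-- `explore`.
exploreCost : ℕ
exploreCost = 250

module _ {n : ℕ} {G : Graph n} (L : AdjacencyLists G) (p q r s c : Fin n) where
  open Graph G
  open AdjacencyLists L

  private
    Cf = Conflict G p q r s c
    Fd = Forced G p q r s c

  Reached : State → List (Fin n) → Fin n → Set
  Reached σ st u = arrs σ aDone (toℕ u) ≡ 1 ⊎ u ∈ᴸ st

  -- The four units per neighbour of an unprocessed vertex: one for the scan of its list, one for
  -- popping what that scan pushes, two for its deposit as the new reference vertex.
  weight : ℕ → ℕ → ℕ
  weight zero    d = 4 * d
  weight (suc _) d = 0

  weight≤ : ∀ k d → weight k d ≤ 4 * d
  weight≤ zero d = ≤-refl
  weight≤ (suc k) d = z≤n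

  -- Units that pay for the rest of the exploration.  Processing v costs
  -- deg v + deg w, w being the reference vertex of its class, and pushes at
  -- most as many vertices, each of which costs one unit when popped.  Since
  -- v replaces w, the cost 2 deg w is refunded by the last sum, whereas the
  -- new summand 2 deg v is paid for by v itself.
  potential : State → List (Fin n) → (Fin 4 → Fin n) → ℕ
  potential σ st rf = length st +
      (sum (λ v → weight (arrs σ aDone (toℕ v)) (deg L v)) + sum (λ k → 2 * deg L (rf k)))

  record Classified (σ : State) : Set where
    field
      input : Input L σ
      opp≡  : ∀ u → arrs σ aOpp (toℕ u) ≡ opp G p q r s c u
      cls≡  : ∀ v → arrs σ aCls (toℕ v) ≡ cls G p q r s c v

  Classified-resp : ∀ {P σ σ′} → writesVar P 0 ≡ false → writesArr P 0 ≡ false → writesArr P 1 ≡ false →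
    writesArr P aOpp ≡ false → writesArr P aCls ≡ false → Unchanged P σ σ′ → Classified σ → Classified σ′
  Classified-resp w0 a0 a1 aO aC u C = record
    { input = Input-resp L w0 a0 a1 u input
    ; opp≡ = λ v → trans (cong (λ f → f (toℕ v)) (arr≡ u aOpp aO)) (opp≡ v)
    ; cls≡ = λ v → trans (cong (λ f → f (toℕ v)) (arr≡ u aCls aC)) (cls≡ v)
    }
    where open Classified C

  -- The two soundness fields keep the done vertices inside `Forced`; the seeds and `closed` give
  -- the converse once the stack is empty.
  record Explored (σ : State) (st : List (Fin n)) (rf : Fin 4 → Fin n) : Set where
    field
      classified : Classified σ
      ref≡       : ∀ (k : Fin 4) → arrs σ aRef (toℕ k) ≡ toℕ (rf k)
      done-flag  : ∀ (v : Fin n) → arrs σ aDone (toℕ v) ≡ 0 ⊎ arrs σ aDone (toℕ v) ≡ 1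
      -- Only the processing of `v` writes the stamp v + 1, so no stale copy exists when `v` is
      -- first taken up.
      stamped    : ∀ (u v : Fin n) → arrs σ aStamp (toℕ u) ≡ suc (toℕ v) → arrs σ aDone (toℕ v) ≡ 1
      p-reached  : Reached σ st p
      q-reached  : Reached σ st q
      c-reached  : Reached σ st c
      closed     : ∀ {v u} → arrs σ aDone (toℕ v) ≡ 1 → Cf v u → Reached σ st u
      -- A vertex of opp-class k is either a neighbour of the reference vertex
      -- of class k, or known to be forced.
      refs       : ∀ k u → toℕ k ≡ opp G p q r s c u → ¬ Adj (rf k) u → Reached σ st u
      done-sound : ∀ {v} → arrs σ aDone (toℕ v) ≡ 1 → Fd v
      st-sound   : ∀ {v} → v ∈ᴸ st → Fd v

  Explored-vars : ∀ {σ vs st rf} → vs 0 ≡ vars σ 0 → Explored σ st rf → Explored (state vs (arrs σ)) st rf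
  Explored-vars eq E = record
    { classified = record
      { input = record { size = trans eq (Input.size input) ; start = Input.start input
          ; stop = Input.stop input }
      ; opp≡ = opp≡ ; cls≡ = cls≡ }
    ; ref≡ = ref≡ ; done-flag = done-flag ; stamped = stamped
    ; p-reached = p-reached ; q-reached = q-reached ; c-reached = c-reached
    ; closed = closed ; refs = refs ; done-sound = done-sound ; st-sound = st-sound
    }
    where
    open Explored E
    open Classified classified

  Explored-skip : ∀ {σ v st rf} → arrs σ aDone (toℕ v) ≡ 1 → Explored σ (v ∷ st) rf → Explored σ st rf
  Explored-skip {σ} {v} {st} dv E = record
    { classified = classified ; ref≡ = ref≡ ; done-flag = done-flag ; stamped = stamped
    ; p-reached = drop p-reached ; q-reached = drop q-reached ; c-reached = drop c-reached
    ; closed = λ d k → drop (closed d k) ; refs = λ k u e a → drop (refs k u e a)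
    ; done-sound = done-sound ; st-sound = st-sound ∘ there
    }
    where
    open Explored E
    drop : ∀ {u} → Reached σ (v ∷ st) u → Reached σ st u
    drop (inj₁ d) = inj₁ d
    drop (inj₂ (here refl)) = inj₁ dv
    drop (inj₂ (there h)) = inj₂ h

  Invariant : ℕ → State → Set
  Invariant units σ = ∃[ st ] ∃[ rf ]
    (Explored σ st rf × Stack (arrs σ aStack) (vars σ rLen) st × potential σ st rf ≤ units)

  cls<4 : ∀ v → cls G p q r s c v < 4
  cls<4 v with adj? r v | adj? s v
  ... | yes _ | yes _ = ≤ᵇ⇒≤ 4 4 _
  ... | yes _ | no _ = ≤ᵇ⇒≤ 2 4 _
  ... | no _ | yes _ = ≤ᵇ⇒≤ 3 4 _
  ... | no _ | no _ = ≤ᵇ⇒≤ 1 4 _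

  -- `A` stands for the weights and `B` for the deposits. The weights fall by 4 dv and the deposits
  -- change by 2 dv - 2 dw, which leaves 2 dv + 2 dw for scans and pushes. Adding 2 dv to both sides
  -- avoids subtraction.
  units-balance : ∀ {l l₁ l₂ A A′ B B′ dv dw u} → l₁ ≤ dv → l₂ ≤ dw → A′ + 4 * dv ≤ A + 0 →
    B′ + 2 * dw ≤ B + 2 * dv → suc l + (A + B) ≤ u → suc (dv + dw) + (l₂ + (l₁ + l) + (A′ + B′)) ≤ u
  units-balance {l} {l₁} {l₂} {A} {A′} {B} {B′} {dv} {dw} {u} h₁ h₂ hA hB hu =
    +-cancelʳ-≤ (2 * dv) _ u (begin
      suc (dv + dw) + (l₂ + (l₁ + l) + (A′ + B′)) + 2 * dv
        ≤⟨ +-monoˡ-≤ (2 * dv) (+-monoʳ-≤ (suc (dv + dw))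
            (+-monoˡ-≤ (A′ + B′) (+-mono-≤ h₂ (+-monoˡ-≤ l h₁)))) ⟩
      suc (dv + dw) + (dw + (dv + l) + (A′ + B′)) + 2 * dv
        ≡⟨ solve 5 (λ dv dw l A B → con 1 :+ (dv :+ dw) :+ (dw :+ (dv :+ l) :+ (A :+ B)) :+ con 2 :* dv
                     := con 1 :+ l :+ ((A :+ con 4 :* dv) :+ (B :+ con 2 :* dw))) refl dv dw l A′ B′ ⟩
      suc l + ((A′ + 4 * dv) + (B′ + 2 * dw))
        ≤⟨ +-monoʳ-≤ (suc l) (+-mono-≤ hA hB) ⟩
      suc l + ((A + 0) + (B + 2 * dv))
        ≡⟨ solve 4 (λ dv l A B → con 1 :+ l :+ ((A :+ con 0) :+ (B :+ con 2 :* dv)) := con 1 :+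
            l :+ (A :+ B) :+ con 2 :* dv) refl dv l A B ⟩
      suc l + (A + B) + 2 * dv
        ≤⟨ +-monoˡ-≤ (2 * dv) hu ⟩
      u + 2 * dv ∎)
    where
    open ≤-Reasoning
    open +-*-Solver

  record Entered (v : Fin n) (rf : Fin 4 → Fin n) (k : Fin 4) (σ σ₁ : State) : Set where
    field
      done≡ : arrs σ₁ aDone ≡ update (arrs σ aDone) (toℕ v) 1
      mark≡ : vars σ₁ rMark ≡ suc (toℕ v)
      v≡    : vars σ₁ rV ≡ toℕ v
      k≡    : vars σ₁ rK ≡ cls G p q r s c v
      w≡    : vars σ₁ rW ≡ toℕ (rf k)

  record Processed (v w : Fin n) (st : List (Fin n)) (σ σ₁ : State) : Set where
    field
      new₁ new₂ : List (Fin n)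
      ref≡    : arrs σ₁ aRef ≡ update (arrs σ aRef) (vars σ rK) (toℕ v)
      stamp≡  : ∀ u → (Adj v u × arrs σ₁ aStamp (toℕ u) ≡ suc (toℕ v))
                    ⊎ (¬ Adj v u × arrs σ₁ aStamp (toℕ u) ≡ arrs σ aStamp (toℕ u))
      stack   : Stack (arrs σ₁ aStack) (vars σ₁ rLen) (new₂ ++ (new₁ ++ st))
      len₁    : length new₁ ≤ deg L v
      len₂    : length new₂ ≤ deg L w
      sound₁  : ∀ {u} → u ∈ᴸ new₁ → Cf v u
      sound₂  : ∀ {u} → u ∈ᴸ new₂ → Cf v u
      compl₁  : ∀ {u} → Adj v u → Cf v u → u ∈ᴸ new₁
      compl₂  : ∀ {u} → Adj w u → Cf v u → u ∈ᴸ new₂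

  -- Freshness of the stamp v + 1 is what makes the stamp array an exact adjacency test for `v`
  -- during both scans.
  process-rule : ∀ {σ v w st} → Classified σ → vars σ rMark ≡ suc (toℕ v) → vars σ rV ≡ toℕ v →
    vars σ rK ≡ cls G p q r s c v → vars σ rW ≡ toℕ w → Stack (arrs σ aStack) (vars σ rLen) st →
    (∀ u → arrs σ aStamp (toℕ u) ≢ suc (toℕ v)) →
    Runs process σ (13 * suc (deg L v) + (60 * suc (deg L v) + (60 * suc (deg L w) + 3)))
        (Processed v w st σ)
  process-rule {σ} {v} {w} {st} C m≡ v≡ k≡ w≡ stk fresh =
    Runs-⨾ (mark-rule L aStamp rV v refl refl (Classified.input C) v≡) λ {σ₁} u₁ stamps →
    let C₁ = Classified-resp {P = mark aStamp rV} refl refl refl refl refl u₁ C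
        stamps₁ = fresh-stamps {σ₁} stamps
        m₁ = trans (var≡ u₁ rMark refl) m≡ in
    Runs-⨾ (pushConflicts-rule L p q r s c rV v v refl (Classified.input C₁) (trans (var≡ u₁ rV refl) v≡)
             (subst (λ m → ∀ u → (Adj v u × arrs σ₁ aStamp (toℕ u) ≡ m)
                 ⊎ (¬ Adj v u × arrs σ₁ aStamp (toℕ u) ≢ m)) (sym m₁) stamps₁)
             (trans (var≡ u₁ rK refl) k≡) (Classified.opp≡ C₁)
             (subst₂ (λ f l → Stack f l st) (sym (arr≡ u₁ aStack refl)) (sym (var≡ u₁ rLen refl)) stk))
    λ { {σ₂} u₂ (new₁ , stk₁ , len₁ , sound₁ , compl₁) →
    let C₂ = Classified-resp {P = pushConflicts rV} refl refl refl refl refl u₂ C₁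
        m₂ = trans (var≡ u₂ rMark refl) m₁ in
    Runs-⨾ (pushConflicts-rule L p q r s c rW v w refl (Classified.input C₂)
             (trans (var≡ u₂ rW refl) (trans (var≡ u₁ rW refl) w≡))
             (subst₂ (λ m f → ∀ u → (Adj v u × f (toℕ u) ≡ m) ⊎ (¬ Adj v u × f (toℕ u) ≢ m))
                 (sym m₂) (sym (arr≡ u₂ aStamp refl)) stamps₁)
             (trans (var≡ u₂ rK refl) (trans (var≡ u₁ rK refl) k≡)) (Classified.opp≡ C₂) stk₁)
    λ { {σ₃} u₃ (new₂ , stk₂ , len₂ , sound₂ , compl₂) →
    Runs-wp (aRef [ var rK ]≔ var rV) record
      { new₁ = new₁ ; new₂ = new₂
      ; ref≡ = cong₃ update (trans (arr≡ u₃ aRef refl) (trans (arr≡ u₂ aRef refl) (arr≡ u₁ aRef refl)))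
                 (trans (var≡ u₃ rK refl) (trans (var≡ u₂ rK refl) (var≡ u₁ rK refl)))
                 (trans (var≡ u₃ rV refl) (trans (var≡ u₂ rV refl) (trans (var≡ u₁ rV refl) v≡)))
      ; stamp≡ = subst (λ f → ∀ u → (Adj v u × f (toℕ u) ≡ suc (toℕ v))
          ⊎ (¬ Adj v u × f (toℕ u) ≡ arrs σ aStamp (toℕ u)))
                   (sym (trans (arr≡ u₃ aStamp refl) (arr≡ u₂ aStamp refl)))
                   (subst (λ m → ∀ u → (Adj v u × arrs σ₁ aStamp (toℕ u) ≡ m)
                       ⊎ (¬ Adj v u × arrs σ₁ aStamp (toℕ u) ≡ arrs σ aStamp (toℕ u)))
                      m≡ stamps)
      ; stack = stk₂ ; len₁ = len₁ ; len₂ = len₂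
      ; sound₁ = sound₁ ; sound₂ = sound₂ ; compl₁ = compl₁ ; compl₂ = compl₂
      } } }
    where
    cong₃ : ∀ {A B C D : Set} (f : A → B → C → D) {a a′ b b′ c c′} → a ≡ a′ → b ≡ b′ → c ≡ c′
        → f a b c ≡ f a′ b′ c′
    cong₃ f refl refl refl = refl
    fresh-stamps : ∀ {σ₁} →
      (∀ u → (Adj v u × arrs σ₁ aStamp (toℕ u) ≡ vars σ rMark)
          ⊎ (¬ Adj v u × arrs σ₁ aStamp (toℕ u) ≡ arrs σ aStamp (toℕ u))) →
      ∀ u → (Adj v u × arrs σ₁ aStamp (toℕ u) ≡ suc (toℕ v))
          ⊎ (¬ Adj v u × arrs σ₁ aStamp (toℕ u) ≢ suc (toℕ v))
    fresh-stamps stamps u with stamps u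
    ... | inj₁ (a , eq) = inj₁ (a , trans eq m≡)
    ... | inj₂ (¬a , eq) = inj₂ (¬a , λ h → fresh u (trans (sym eq) h))

  enter-rule : ∀ {σ v st rf} k → toℕ k ≡ cls G p q r s c v → Explored σ (v ∷ st) rf → vars σ rV ≡ toℕ v →
               Runs enter σ (bound enter) (Entered v rf k σ)
  enter-rule {σ} {v} {rf = rf} k k≡ E v≡ = Runs-wp enter record
    { done≡ = cong (λ i → update (arrs σ aDone) i 1) v≡
    ; mark≡ = cong suc v≡
    ; v≡ = v≡
    ; k≡ = rK≡
    ; w≡ = trans (cong (arrs σ aRef) (trans rK≡ (sym k≡))) (ref≡ k)
    }
    where
    open Explored E
    rK≡ : arrs σ aCls (vars σ rV) ≡ cls G p q r s c v
    rK≡ = trans (cong (arrs σ aCls) v≡) (Classified.cls≡ classified v)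

  Explored-process : ∀ {σ σ₁ σ₂ v st rf} k → toℕ k ≡ cls G p q r s c v →
    Explored σ (v ∷ st) rf → arrs σ aDone (toℕ v) ≡ 0 →
    Unchanged enter σ σ₁ → Entered v rf k σ σ₁ → Unchanged process σ₁ σ₂
        → (Pr : Processed v (rf k) st σ₁ σ₂) →
    Explored σ₂ (Processed.new₂ Pr ++ (Processed.new₁ Pr ++ st)) (updateAt rf k (const v))
  Explored-process {σ} {σ₁} {σ₂} {v} {st} {rf} k k≡ E d0 u₁ En u₂ Pr = record
    { classified = Classified-resp {P = process} refl refl refl refl refl u₂
                     (Classified-resp {P = enter} refl refl refl refl refl u₁ classified)
    ; ref≡ = ref≡′
    ; done-flag = λ x → case done-cases x of λ
        { (inj₁ (_ , d)) → inj₂ d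
        ; (inj₂ (_ , eq)) → Sum.map (trans eq) (trans eq) (done-flag x) }
    ; stamped = stamped′
    ; p-reached = mono p-reached ; q-reached = mono q-reached ; c-reached = mono c-reached
    ; closed = closed′
    ; refs = refs′
    ; done-sound = λ {x} d → case done-cases x of λ
        { (inj₁ (refl , _)) → v-forced
        ; (inj₂ (_ , eq)) → done-sound (trans (sym eq) d) }
    ; st-sound = st-sound′
    }
    where
    open Explored E
    module N = Entered En
    module P = Processed Pr
    st′ : List (Fin n)
    st′ = P.new₂ ++ (P.new₁ ++ st)
    v-forced : Fd v
    v-forced = st-sound (here refl)
    done≡ : arrs σ₂ aDone ≡ update (arrs σ aDone) (toℕ v) 1
    done≡ = trans (arr≡ u₂ aDone refl) N.done≡
    done-cases : ∀ x → (x ≡ v × arrs σ₂ aDone (toℕ x) ≡ 1)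
        ⊎ (x ≢ v × arrs σ₂ aDone (toℕ x) ≡ arrs σ aDone (toℕ x))
    done-cases x with update-cases (arrs σ aDone) (toℕ v) {1} (toℕ x)
    ... | inj₁ (x≡v , eq) = inj₁ (toℕ-injective x≡v , trans (cong (λ f → f (toℕ x)) done≡) eq)
    ... | inj₂ (x≢v , eq) = inj₂ (x≢v ∘ cong toℕ , trans (cong (λ f → f (toℕ x)) done≡) eq)
    done-v : arrs σ₂ aDone (toℕ v) ≡ 1
    done-v with done-cases v
    ... | inj₁ (_ , d) = d
    ... | inj₂ (v≢v , _) = contradiction refl v≢v
    done-mono : ∀ {x} → arrs σ aDone (toℕ x) ≡ 1 → arrs σ₂ aDone (toℕ x) ≡ 1
    done-mono {x} d with done-cases x
    ... | inj₁ (_ , d′) = d′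
    ... | inj₂ (_ , eq) = trans eq d
    mono : ∀ {x} → Reached σ (v ∷ st) x → Reached σ₂ st′ x
    mono (inj₁ d) = inj₁ (done-mono d)
    mono (inj₂ (here refl)) = inj₁ done-v
    mono (inj₂ (there h)) = inj₂ (∈-++⁺ʳ P.new₂ (∈-++⁺ʳ P.new₁ h))
    ref≡′ : ∀ j → arrs σ₂ aRef (toℕ j) ≡ toℕ (updateAt rf k (const v) j)
    ref≡′ j = trans (cong (λ f → f (toℕ j))
        (trans P.ref≡ (cong₂ (λ f i → update f i (toℕ v)) (arr≡ u₁ aRef refl)
            (trans N.k≡ (sym k≡))))) (eq j)
      where
      eq : ∀ j → update (arrs σ aRef) (toℕ k) (toℕ v) (toℕ j) ≡ toℕ (updateAt rf k (const v) j)
      eq j with update-cases (arrs σ aRef) (toℕ k) {toℕ v} (toℕ j)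
      ... | inj₁ (j≡k , eq) rewrite toℕ-injective j≡k = trans eq (cong toℕ (sym (updateAt-updates k rf)))
      ... | inj₂ (j≢k , eq) = trans eq
          (trans (ref≡ j) (cong toℕ (sym (updateAt-minimal j k rf (j≢k ∘ cong toℕ)))))
    stamped′ : ∀ x y → arrs σ₂ aStamp (toℕ x) ≡ suc (toℕ y) → arrs σ₂ aDone (toℕ y) ≡ 1
    stamped′ x y h with P.stamp≡ x
    ... | inj₁ (_ , eq) rewrite toℕ-injective (suc-injective (trans (sym h) eq)) = done-v
    ... | inj₂ (_ , eq) = done-mono
        (stamped x y (trans (sym (cong (λ f → f (toℕ x)) (arr≡ u₁ aStamp refl))) (trans (sym eq) h)))
    v-closed : ∀ {x} → Cf v x → Reached σ₂ st′ x
    v-closed {x} cf@(inj₁ (vx , _)) = inj₂ (∈-++⁺ʳ P.new₂ (∈-++⁺ˡ (P.compl₁ vx cf)))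
    -- A non-adjacent conflict has opp-class `k`: it is met in the list of the old reference vertex,
    -- or `refs` has it reached already.
    v-closed {x} cf@(inj₂ (_ , eq)) with adj? (rf k) x
    ... | yes wx = inj₂ (∈-++⁺ˡ (P.compl₂ wx cf))
    ... | no ¬wx = mono (refs k x (trans k≡ eq) ¬wx)
    closed′ : ∀ {y x} → arrs σ₂ aDone (toℕ y) ≡ 1 → Cf y x → Reached σ₂ st′ x
    closed′ {y} d cf with done-cases y
    ... | inj₁ (refl , _) = v-closed cf
    ... | inj₂ (_ , eq) = mono (closed (trans (sym eq) d) cf)
    refs′ : ∀ j x → toℕ j ≡ opp G p q r s c x → ¬ Adj (updateAt rf k (const v) j) x → Reached σ₂ st′ x
    refs′ j x eq ¬a with j Fin.≟ k
    -- The new reference vertex of class `k` is `v`, whose non-neighbours of opp-class `k` are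
    -- conflicts of `v` and have just been reached.
    ... | yes refl = v-closed (inj₂
        (subst (λ w → ¬ Adj w x) (updateAt-updates k rf) ¬a , trans (sym k≡) eq))
    ... | no j≢k = mono (refs j x eq (subst (λ w → ¬ Adj w x) (updateAt-minimal j k rf j≢k) ¬a))
    st-sound′ : ∀ {x} → x ∈ᴸ st′ → Fd x
    st-sound′ h with ∈-++⁻ P.new₂ h
    ... | inj₁ h₂ = forces v-forced (P.sound₂ h₂)
    ... | inj₂ h′ with ∈-++⁻ P.new₁ h′
    ...   | inj₁ h₁ = forces v-forced (P.sound₁ h₁)
    ...   | inj₂ h₀ = st-sound (there h₀)

  potential-process : ∀ {σ σ₁ σ₂ v st rf u} k →
    arrs σ aDone (toℕ v) ≡ 0 → Unchanged enter σ σ₁ → Entered v rf k σ σ₁ → Unchanged process σ₁ σ₂ →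
    (Pr : Processed v (rf k) st σ₁ σ₂) → potential σ (v ∷ st) rf ≤ u →
    suc (deg L v + deg L (rf k)) +
      potential σ₂ (Processed.new₂ Pr ++ (Processed.new₁ Pr ++ st)) (updateAt rf k (const v)) ≤ u
  potential-process {σ} {σ₁} {σ₂} {v} {st} {rf} {u} k d0 u₁ En u₂ Pr paid
    rewrite length-++ (Processed.new₂ Pr) {Processed.new₁ Pr ++ st} | length-++ (Processed.new₁ Pr) {st} =
    units-balance {A = A σ} {A σ₂} {B rf} {B (updateAt rf k (const v))} P.len₁ P.len₂
      (sum-exchange v other (≤-reflexive at-v))
      (sum-exchange k (λ j j≢k → ≤-reflexive (cong (λ w → 2 * deg L w) (updateAt-minimal j k rf j≢k)))
        (≤-reflexive (trans (cong (λ w → 2 * deg L w + 2 * deg L (rf k)) (updateAt-updates k rf))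
            (+-comm (2 * deg L v) _))))
      paid
    where
    A : State → ℕ
    A τ = sum (λ x → weight (arrs τ aDone (toℕ x)) (deg L x))
    B : (Fin 4 → Fin n) → ℕ
    B f = sum (λ j → 2 * deg L (f j))
    module N = Entered En
    module P = Processed Pr
    done≡ : arrs σ₂ aDone ≡ update (arrs σ aDone) (toℕ v) 1
    done≡ = trans (arr≡ u₂ aDone refl) N.done≡
    other : ∀ j → j ≢ v → weight (arrs σ₂ aDone (toℕ j)) (deg L j) ≤ weight (arrs σ aDone (toℕ j)) (deg L j)
    other j j≢v = ≤-reflexive (cong (λ x → weight x (deg L j))
      (trans (cong (λ f → f (toℕ j)) done≡) (update-other (arrs σ aDone) (j≢v ∘ toℕ-injective))))
    at-v : weight (arrs σ₂ aDone (toℕ v)) (deg L v) + 4 * deg L v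
        ≡ weight (arrs σ aDone (toℕ v)) (deg L v) + 0
    at-v rewrite done≡ | update-same (arrs σ aDone) (toℕ v) {1} | d0 = sym (+-identityʳ _)

  explore-rule : ∀ {u σ} → Invariant u σ → Runs explore σ (exploreCost * u + 3) λ σ′
      → Flags (arrs σ′ aDone) Fd
  explore-rule inv = Runs-mono ≤-refl (λ _ → λ { ((_ , st , rf , E , stk , _) , stop) → final E stk stop })
    (while-rule (lit 0 << var rLen) _ exploreCost Invariant step inv)
    where
    final : ∀ {σ st rf} → Explored σ st rf → Stack (arrs σ aStack) (vars σ rLen) st → vars σ rLen ≤ 0 →
            Flags (arrs σ aDone) Fd
    final {σ} E stk l≤0 with Stack-empty l≤0 stk
    ... | refl = flags λ v → case done-flag v of λ
        { (inj₁ d0) → inj₂ ((λ f → case trans (sym d0) (done f) of λ ()) , d0)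
        ; (inj₂ d1) → inj₁ (done-sound d1 , d1) }
      where
      open Explored E
      -- With an empty stack, reached means done, so induction on `Forced` shows every forced vertex
      -- done.
      reached : ∀ {v} → Reached σ [] v → arrs σ aDone (toℕ v) ≡ 1
      reached (inj₁ d) = d
      done : ∀ {v} → Fd v → arrs σ aDone (toℕ v) ≡ 1
      done seed-p = reached p-reached
      done seed-q = reached q-reached
      done seed-c = reached c-reached
      done (forces f cf) = reached (closed (done f) cf)

    step : ∀ {u σ} → Invariant u σ → 0 < vars σ rLen →
           ∃[ d ] ∃[ T ] ((3 + T ≤ exploreCost * suc d)
             × Runs (pop ⨾ cond (aDone [ var rV ] == lit 1) skip (enter ⨾ process)) σ T
                 λ σ′ → ∃[ u′ ] (suc d + u′ ≤ u × Invariant u′ σ′))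
    step {u} {σ} (st₀ , rf , E , stk , paid) 0<l with Stack-nonempty 0<l stk
    ... | v , st , refl with Stack-pop stk | Explored.done-flag E v
    -- A duplicate uses up one unit, namely its own entry in the stack length.
    ...   | v≡ , stk′ | inj₂ d1 = 0 , _ , ≤ᵇ⇒≤ (3 + (bound pop + (4 + (1 + 0)))) (exploreCost * 1) _
            , Runs-⨾ (Runs-wp pop {Q = λ σ₁ → σ₁ ≡ σ₀} refl) λ { _ refl →
                Runs-cond
                  (λ _ → Runs-wp skip (_ , paid , st , rf , Explored-vars refl (Explored-skip d1 E)
                      , stk′ , ≤-refl))
                  (λ ¬d → contradiction (trans (cong (arrs σ aDone) v≡) d1) ¬d) }
            where
            σ₀ : State
            σ₀ = setVar (setVar σ rLen (pred (vars σ rLen))) rV (arrs σ aStack (pred (vars σ rLen)))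
    ...   | v≡ , stk′ | inj₁ d0 = deg L v + deg L (rf k) , _ , cost
            , Runs-⨾ (Runs-wp pop {Q = λ σ₁ → σ₁ ≡ σ₀} refl) λ { _ refl →
                -- The branch for done vertices is contradictory here and may be allotted no time.
                Runs-cond {T₁ = 0}
                  (λ d → case trans (sym d0) (trans (sym (cong (arrs σ aDone) v≡)) d) of λ ())
                  (λ _ → Runs-⨾ (enter-rule k k≡ E₀ v≡) λ {σ₁} u₁ En →
                    let module N = Entered En in
                    Runs-mono ≤-refl (λ u₂ Pr → _ , potential-process k d0 u₁ En u₂ Pr paid ,
                        _ , _ , Explored-process k k≡ E₀ d0 u₁ En u₂ Pr , Processed.stack Pr , ≤-refl)
                      (process-rule (Classified-resp {P = enter} refl refl refl refl refl u₁
                          (Explored.classified E₀))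
                        N.mark≡ N.v≡ N.k≡ N.w≡
                        (subst₂ (λ f l → Stack f l st) (sym (arr≡ u₁ aStack refl))
                            (sym (var≡ u₁ rLen refl)) stk′)
                        (λ x h → case trans (sym d0) (Explored.stamped E x v
                            (trans (cong (λ f → f (toℕ x)) (sym (arr≡ u₁ aStamp refl))) h)) of λ ()))) }
            where
            σ₀ : State
            σ₀ = setVar (setVar σ rLen (pred (vars σ rLen))) rV (arrs σ aStack (pred (vars σ rLen)))
            E₀ : Explored σ₀ (v ∷ st) rf
            E₀ = Explored-vars refl E
            k : Fin 4
            k = Fin.fromℕ< (cls<4 v)
            k≡ : toℕ k ≡ cls G p q r s c v
            k≡ = toℕ-fromℕ< (cls<4 v)
            dv = deg L v
            dw = deg L (rf k)
            left : suc dv ≤ suc (dv + dw)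
            left = s≤s (m≤m+n dv dw)
            right : suc dw ≤ suc (dv + dw)
            right = s≤s (m≤n+m dw dv)
            cost : 3 + (bound pop + (4 + (0 + (bound enter +
                     (13 * suc dv + (60 * suc dv + (60 * suc dw + 3))))))) ≤ exploreCost * suc (dv + dw)
            cost = within-≤ (≤ᵇ⇒≤ (3 + (bound pop
                + (4 + (0 + (bound enter + (13 + (60 + (60 + 3)))))))) exploreCost _)
              (const-within 3 ⊕ const-within (bound pop) ⊕ const-within 4 ⊕ const-within 0
                  ⊕ const-within (bound enter) ⊕
               scale-within 13 left ⊕ scale-within 60 left ⊕ scale-within 60 right ⊕ const-within 3)

-- One side of the 2-join

≤-sum : ∀ {m} (f : Fin m → ℕ) i → f i ≤ sum f
≤-sum f 0F = m≤m+n _ _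
≤-sum f (Fin.suc i) = ≤-trans (≤-sum (f ∘ Fin.suc) i) (m≤n+m _ (f 0F))

code-4≢0 : ∀ {A B : Set} (a : Dec A) (b : Dec B) → code 4 a b ≢ 0
code-4≢0 (yes _) (yes _) ()
code-4≢0 (yes _) (no _) ()
code-4≢0 (no _) (yes _) ()
code-4≢0 (no _) (no _) ()

code-4≡1 : ∀ {A B : Set} (a : Dec A) (b : Dec B) → code 4 a b ≡ 1 → A
code-4≡1 (yes x) _ _ = x
code-4≡1 (no _) (yes _) ()
code-4≡1 (no _) (no _) ()

code-4≡2 : ∀ {A B : Set} (a : Dec A) (b : Dec B) → code 4 a b ≡ 2 → B
code-4≡2 _ (yes y) _ = y
code-4≡2 (yes _) (no _) ()
code-4≡2 (no _) (no _) ()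

code-4≡3 : ∀ {A B : Set} (a : Dec A) (b : Dec B) → code 4 a b ≡ 3 → A
code-4≡3 (yes x) _ _ = x
code-4≡3 (no _) (yes _) ()
code-4≡3 (no _) (no _) ()

prepare : ℕ → ℕ → Program
prepare A w = clear A ⨾ mark A w

aP aQ aR aS : ℕ
aP = 3
aQ = 4
aR = 5
aS = 6

seeds setup verdict decide : Program
seeds =
  aRef [ lit 0 ]≔ var rp ⨾ aRef [ lit 1 ]≔ var rp ⨾ aRef [ lit 2 ]≔ var rq ⨾ aRef [ lit 3 ]≔ var rp ⨾
  aStack [ lit 0 ]≔ var rc ⨾ aStack [ lit 1 ]≔ var rq ⨾ aStack [ lit 2 ]≔ var rp ⨾ rLen ≔ lit 3

setup =
  rMark ≔ lit 1 ⨾ prepare aP rp ⨾ prepare aQ rq ⨾ prepare aR rr ⨾ prepare aS rs ⨾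
  classify aOpp aP aQ 4 ⨾ classify aCls aR aS 0 ⨾ clear aDone ⨾ clear aStamp ⨾ seeds

forbiddenᵀ thirdᵀ : Test
forbiddenᵀ = aDone [ var rI ] == lit 1 &&
             -- The negation of `Allowed`; tests offer no disjunction, hence the De Morgan form.
             neg (neg (aCls [ var rI ] == lit 3) && neg (var rI == var rr) && neg (var rI == var rs))
thirdᵀ     = neg (aDone [ var rI ] == lit 1) && neg (var rI == var rr) && neg (var rI == var rs)

verdict = search forbiddenᵀ ⨾
          -- The convention of `search` agrees with that of register 5: zero means that there is no
          -- solution.
          cond (var rFound == lit 0) (search thirdᵀ ⨾ 5 ≔ var rFound) (5 ≔ lit 0)

decide = setup ⨾ explore ⨾ verdict

module _ {n : ℕ} {G : Graph n} (L : AdjacencyLists G) where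
  open Graph G

  total : ℕ
  total = sum (deg L)

  deg≤total : ∀ v → suc (deg L v) ≤ suc (n + total)
  deg≤total v = s≤s (≤-trans (≤-sum (deg L) v) (m≤n+m total n))

  size≤total : suc n ≤ suc (n + total)
  size≤total = s≤s (m≤m+n n total)

  prepare-rule : ∀ A w v {σ} → (0 ≡ᵇ A) ≡ false → (1 ≡ᵇ A) ≡ false → (w ≡ᵇ rI) ≡ false →
    Input L σ → vars σ w ≡ toℕ v → vars σ rMark ≡ 1 →
    Runs (prepare A w) σ (9 * suc n + 13 * suc (deg L v)) λ σ′ → Flags (arrs σ′ A) (Adj v)
  prepare-rule A w v {σ} A≢0 A≢1 w≢ I w≡ m≡ =
    Runs-⨾ (clear-rule A (Input.size I)) λ {σ₁} u₁ zeros →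
    Runs-mono ≤-refl (λ {σ₂} _ h → flags λ u → marked {σ₁} {σ₂} u₁ (zeros u) (h u))
      (mark-rule L A w v A≢1 w≢
        (Input-resp L refl (unwritten 0 A≢0) (unwritten 1 A≢1) u₁ I)
        (trans (var≡ u₁ w w-unwritten) w≡))
    where
    unwritten : ∀ B → (B ≡ᵇ A) ≡ false → writesArr (clear A) B ≡ false
    unwritten B h rewrite h = refl
    w-unwritten : writesVar (clear A) w ≡ false
    w-unwritten rewrite w≢ = refl
    marked : ∀ {σ₁ σ₂ u} → Unchanged (clear A) σ σ₁ → arrs σ₁ A (toℕ u) ≡ 0 →
      (Adj v u × arrs σ₂ A (toℕ u) ≡ vars σ₁ rMark) ⊎ (¬ Adj v u × arrs σ₂ A (toℕ u) ≡ arrs σ₁ A (toℕ u)) →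
      (Adj v u × arrs σ₂ A (toℕ u) ≡ 1) ⊎ (¬ Adj v u × arrs σ₂ A (toℕ u) ≡ 0)
    marked u₁ z (inj₁ (a , eq)) = inj₁ (a , trans eq (trans (var≡ u₁ rMark refl) m≡))
    marked u₁ z (inj₂ (¬a , eq)) = inj₂ (¬a , trans eq z)

  module _ (p q r s c : Fin n) where

    private
      Fd = Forced G p q r s c
      Al = Allowed G p q r s c

    record Loaded (σ : State) : Set where
      field
        input : Input L σ
        p≡ : vars σ rp ≡ toℕ p
        q≡ : vars σ rq ≡ toℕ q
        r≡ : vars σ rr ≡ toℕ r
        s≡ : vars σ rs ≡ toℕ s
        c≡ : vars σ rc ≡ toℕ c

    Loaded-resp : ∀ {P σ σ′} → writesVar P 0 ≡ false → writesArr P 0 ≡ false → writesArr P 1 ≡ false →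
      writesVar P rp ≡ false → writesVar P rq ≡ false → writesVar P rr ≡ false → writesVar P rs ≡ false →
      writesVar P rc ≡ false → Unchanged P σ σ′ → Loaded σ → Loaded σ′
    Loaded-resp w0 a0 a1 wp wq wr ws wc u R = record
      { input = Input-resp L w0 a0 a1 u input
      ; p≡ = trans (var≡ u rp wp) p≡ ; q≡ = trans (var≡ u rq wq) q≡
      ; r≡ = trans (var≡ u rr wr) r≡ ; s≡ = trans (var≡ u rs ws) s≡
      ; c≡ = trans (var≡ u rc wc) c≡
      }
      where open Loaded R

    -- No vertex has opp-class 0, and those of opp-classes 1 and 3 (of class 2)
    -- are neighbours of p (of q).
    seed-refs : Fin 4 → Fin n
    seed-refs 2F = q
    seed-refs _  = p

    record Cleared (σ : State) : Set where
      field
        classified : Classified L p q r s c σ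
        loaded     : Loaded σ
        done0      : ∀ (v : Fin n) → arrs σ aDone (toℕ v) ≡ 0
        stamp0     : ∀ (v : Fin n) → arrs σ aStamp (toℕ v) ≡ 0

    -- 12 = 4 + 4 * 2: the weights total at most 4 times the degree sum, and each of the four
    -- deposits at most twice it. The three stacked seeds are covered by the `suc`.
    initial-potential : ∀ {σ} → potential L p q r s c σ (p ∷ q ∷ c ∷ []) seed-refs ≤ 12 * suc (n + total)
    initial-potential {σ} = begin
      3 + (sum (λ v → weight L p q r s c (arrs σ aDone (toℕ v)) (deg L v))
          + sum (λ k → 2 * deg L (seed-refs k)))
        ≤⟨ +-monoʳ-≤ 3 (+-mono-≤ (sum-mono (λ v → weight≤ L p q r s c (arrs σ aDone (toℕ v)) (deg L v)))
                                 (sum-mono {f = λ (_ : Fin 4) → 2 * total}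
                                     (λ k → *-monoʳ-≤ 2 (≤-sum (deg L) (seed-refs k))))) ⟩
      3 + (sum (λ v → 4 * deg L v) + sum (λ (_ : Fin 4) → 2 * total))
        ≡⟨ cong (λ x → 3 + (x + sum (λ (_ : Fin 4) → 2 * total))) (sym (*-distribˡ-sum 4 (deg L))) ⟩
      3 + (4 * total + sum (λ (_ : Fin 4) → 2 * total))
        ≡⟨ solve 1 (λ t → con 3 :+ (con 4 :* t :+
            (con 2 :* t :+ (con 2 :* t :+ (con 2 :* t :+ (con 2 :* t :+ con 0)))))
                    := con 3 :+ con 12 :* t) refl total ⟩
      3 + 12 * total
        ≤⟨ +-mono-≤ (≤ᵇ⇒≤ 3 12 _) (*-monoʳ-≤ 12 (m≤n+m total n)) ⟩
      12 + 12 * (n + total)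
        ≡⟨ *-suc 12 (n + total) ⟨
      12 * suc (n + total) ∎
      where
      open ≤-Reasoning
      open +-*-Solver

    seeds-rule : ∀ {σ} → Cleared σ
        → Runs seeds σ (bound seeds) (Invariant L p q r s c (12 * suc (n + total)))
    seeds-rule {σ} Cl = Runs-wp seeds
      ( p ∷ q ∷ c ∷ [] , seed-refs
      , record
          { classified = record
              { input = record { size = size ; start = start ; stop = stop }
              ; opp≡ = opp≡ ; cls≡ = cls≡ }
          ; ref≡ = λ { 0F → p≡ ; 1F → p≡ ; 2F → q≡ ; 3F → p≡ }
          ; done-flag = inj₁ ∘ done0
          ; stamped = λ u v h → contradiction (trans (sym (stamp0 u)) h) λ ()
          ; p-reached = inj₂ (here refl)
          ; q-reached = inj₂ (there (here refl))
          ; c-reached = inj₂ (there (there (here refl)))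
          ; closed = λ {v} d _ → contradiction (trans (sym (done0 v)) d) λ ()
          ; refs = λ
              { 0F u eq ¬a → contradiction (sym eq) (code-4≢0 (adj? p u) (adj? q u))
              ; 1F u eq ¬a → contradiction (code-4≡1 (adj? p u) (adj? q u) (sym eq)) ¬a
              ; 2F u eq ¬a → contradiction (code-4≡2 (adj? p u) (adj? q u) (sym eq)) ¬a
              ; 3F u eq ¬a → contradiction (code-4≡3 (adj? p u) (adj? q u) (sym eq)) ¬a }
          ; done-sound = λ {v} d → contradiction (trans (sym (done0 v)) d) λ ()
          ; st-sound = λ { (here refl) → seed-p ; (there (here refl)) → seed-q
              ; (there (there (here refl))) → seed-c ; (there (there (there ()))) }
          }
      , p≡ ∷ q≡ ∷ c≡ ∷ []
      , initial-potential {σ} )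
      where
      open Cleared Cl
      open Classified classified hiding (input)
      open Loaded loaded
      open Input input

    setup-rule : ∀ {σ} → Loaded σ → Runs setup σ (600 * suc (n + total))
        (Invariant L p q r s c (12 * suc (n + total)))
    setup-rule {σ} R = Runs-mono cost (λ _ → id)
      (Runs-⨾ (Runs-wp (rMark ≔ lit 1) {Q = λ τ → vars τ rMark ≡ 1} refl) λ {σ₁} u₁ m₁ →
      let R₁ = Loaded-resp {P = rMark ≔ lit 1} refl refl refl refl refl refl refl refl u₁ R in
      Runs-⨾ (prepare-rule aP rp p refl refl refl (Loaded.input R₁) (Loaded.p≡ R₁) m₁) λ {σ₂} u₂ FP →
      let R₂ = Loaded-resp {P = prepare aP rp} refl refl refl refl refl refl refl refl u₂ R₁
          m₂ = trans (var≡ u₂ rMark refl) m₁ in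
      Runs-⨾ (prepare-rule aQ rq q refl refl refl (Loaded.input R₂) (Loaded.q≡ R₂) m₂) λ {σ₃} u₃ FQ →
      let R₃ = Loaded-resp {P = prepare aQ rq} refl refl refl refl refl refl refl refl u₃ R₂
          m₃ = trans (var≡ u₃ rMark refl) m₂ in
      Runs-⨾ (prepare-rule aR rr r refl refl refl (Loaded.input R₃) (Loaded.r≡ R₃) m₃) λ {σ₄} u₄ FR →
      let R₄ = Loaded-resp {P = prepare aR rr} refl refl refl refl refl refl refl refl u₄ R₃
          m₄ = trans (var≡ u₄ rMark refl) m₃ in
      Runs-⨾ (prepare-rule aS rs s refl refl refl (Loaded.input R₄) (Loaded.s≡ R₄) m₄) λ {σ₅} u₅ FS →
      let R₅ = Loaded-resp {P = prepare aS rs} refl refl refl refl refl refl refl refl u₅ R₄ in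
      Runs-⨾ (classify-rule aOpp aP aQ 4 (adj? p) (adj? q) refl refl (Input.size (Loaded.input R₅))
                (subst (λ f → Flags f (Adj p))
                    (sym (trans (arr≡ u₅ aP refl) (trans (arr≡ u₄ aP refl) (arr≡ u₃ aP refl)))) FP)
                (subst (λ f → Flags f (Adj q)) (sym (trans (arr≡ u₅ aQ refl) (arr≡ u₄ aQ refl)))
                    FQ)) λ {σ₆} u₆ O →
      let R₆ = Loaded-resp {P = classify aOpp aP aQ 4} refl refl refl refl refl refl refl refl u₆ R₅ in
      Runs-⨾ (classify-rule aCls aR aS 0 (adj? r) (adj? s) refl refl (Input.size (Loaded.input R₆))
                (subst (λ f → Flags f (Adj r)) (sym (trans (arr≡ u₆ aR refl) (arr≡ u₅ aR refl))) FR)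
                (subst (λ f → Flags f (Adj s)) (sym (arr≡ u₆ aS refl)) FS)) λ {σ₇} u₇ C →
      let R₇ = Loaded-resp {P = classify aCls aR aS 0} refl refl refl refl refl refl refl refl u₇ R₆ in
      Runs-⨾ (clear-rule aDone (Input.size (Loaded.input R₇))) λ {σ₈} u₈ D →
      let R₈ = Loaded-resp {P = clear aDone} refl refl refl refl refl refl refl refl u₈ R₇ in
      Runs-⨾ (clear-rule aStamp (Input.size (Loaded.input R₈))) λ {σ₉} u₉ S →
      let R₉ = Loaded-resp {P = clear aStamp} refl refl refl refl refl refl refl refl u₉ R₈ in
      seeds-rule record
        { classified = record
            { input = Loaded.input R₉
            ; opp≡ = λ u → trans (at u (trans (arr≡ u₉ aOpp refl)
                (trans (arr≡ u₈ aOpp refl) (arr≡ u₇ aOpp refl)))) (O u)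
            ; cls≡ = λ u → trans (at u (trans (arr≡ u₉ aCls refl) (arr≡ u₈ aCls refl))) (C u)
            }
        ; loaded = R₉
        ; done0 = λ u → trans (at u (arr≡ u₉ aDone refl)) (D u)
        ; stamp0 = S
        })
      where
      at : ∀ {f g : ℕ → ℕ} (u : Fin n) → f ≡ g → f (toℕ u) ≡ g (toℕ u)
      at u = cong (λ f → f (toℕ u))
      prep : ∀ v → Within (suc (n + total)) (9 + 13) (9 * suc n + 13 * suc (deg L v))
      prep v = scale-within 9 size≤total ⊕ scale-within 13 (deg≤total v)
      cost : 2 + ((9 * suc n + 13 * suc (deg L p))
          + ((9 * suc n + 13 * suc (deg L q)) + ((9 * suc n + 13 * suc (deg L r)) +
             ((9 * suc n + 13 * suc (deg L s))
                 + (30 * suc n + (30 * suc n + (9 * suc n + (9 * suc n + bound seeds))))))))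
                     ≤ 600 * suc (n + total)
      cost = within-≤ (≤ᵇ⇒≤ (2 + (22 + (22 + (22 + (22 + (30 + (30 + (9 + (9 + bound seeds))))))))) 600 _)
        (const-within 2 ⊕ prep p ⊕ prep q ⊕ prep r ⊕ prep s ⊕ scale-within 30 size≤total
            ⊕ scale-within 30 size≤total ⊕
         scale-within 9 size≤total ⊕ scale-within 9 size≤total ⊕ const-within (bound seeds))

    Third : Fin n → Set
    Third x = ¬ Fd x × x ≢ r × x ≢ s

    Verdict : State → Set
    Verdict σ = (vars σ 5 ≡ 0 × ((∃[ v ] (Fd v × ¬ Al v)) ⊎ (∀ x → ¬ Third x)))
              ⊎ ((∃[ k ] vars σ 5 ≡ suc k) × (∀ {v} → Fd v → Al v) × ∃[ x ] Third x)

    verdict-rule : ∀ {σ} → Loaded σ → (∀ v → arrs σ aCls (toℕ v) ≡ cls G p q r s c v)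
        → Flags (arrs σ aDone) Fd →
                   Runs verdict σ (200 * suc (n + total)) λ σ′ → Verdict σ′ × Flags (arrs σ′ aDone) Fd
    verdict-rule {σ} R C F = Runs-mono cost
        (λ u v → v , subst (λ f → Flags f Fd) (sym (arr≡ u aDone refl)) F)
      (Runs-⨾ (search-rule forbiddenᵀ (λ v → Fd v × ¬ Al v) forbidden-spec size) λ {σ₁} u₁ h₁ →
       Runs-cond
         (λ z → Runs-⨾ (search-rule thirdᵀ Third
             (λ i u₂ → third-spec i (Loaded-resp {P = search thirdᵀ} refl refl refl refl refl refl
                 refl refl u₂
                     (Loaded-resp {P = search forbiddenᵀ} refl refl refl refl refl refl refl refl
                         u₁ R)) (trans (arr≡ u₂ aDone refl) (arr≡ u₁ aDone refl)))
                   (trans (var≡ u₁ 0 refl) size)) λ {σ₂} _ h₂ →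
                Runs-wp (5 ≔ var rFound) (conclude {σ₁} {σ₂} h₁ z h₂))
         (λ nz → Runs-wp (5 ≔ lit 0) (reject {σ₁} h₁ nz)))
      where
      open Loaded R
      open Input input
      al? : ∀ v → Dec (Al v)
      al? v = ¬? (cls G p q r s c v ≟ 3) ×-dec (¬? (v Fin.≟ r) ×-dec ¬? (v Fin.≟ s))
      reject : ∀ {τ} → SearchResult (λ v → Fd v × ¬ Al v) τ → vars τ rFound ≢ 0 → Verdict (setVar τ 5 0)
      reject (inj₁ (i , _ , h)) _ = inj₁ (refl , inj₁ (i , h))
      reject (inj₂ (z , _)) nz = contradiction z nz
      conclude : ∀ {τ τ′} → SearchResult (λ v → Fd v × ¬ Al v) τ → vars τ rFound ≡ 0
          → SearchResult Third τ′ →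
                 Verdict (setVar τ′ 5 (vars τ′ rFound))
      conclude (inj₁ (_ , nz , _)) z _ = contradiction (trans (sym z) nz) λ ()
      conclude (inj₂ (_ , none)) z (inj₁ (i , eq , h)) =
        -- The search only excludes a forced vertex that is not allowed; `Al` is decidable, so the
        -- double negation can be removed.
        inj₂ ((toℕ i , eq) , (λ {v} f → decidable-stable (al? v) (λ ¬a → none v (f , ¬a))) , i , h)
      conclude (inj₂ (_ , none)) z (inj₂ (eq , h)) = inj₁ (eq , inj₂ h)
      module _ {τ} (i : Fin n) (Rτ : Loaded τ) (i≡ : vars τ rI ≡ toℕ i)
          (D : arrs τ aDone ≡ arrs σ aDone) where
        ≡reg : ∀ {x y} → vars τ x ≡ toℕ y → vars τ rI ≡ vars τ x → i ≡ y
        ≡reg e h = toℕ-injective (trans (sym i≡) (trans h e))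
        reg≡ : ∀ {x y} → vars τ x ≡ toℕ y → i ≡ y → vars τ rI ≡ vars τ x
        reg≡ e refl = trans i≡ (sym e)
        done≡ : arrs τ aDone (vars τ rI) ≡ arrs σ aDone (toℕ i)
        done≡ = cong₂ (λ f j → f j) D i≡
        yes-done : arrs τ aDone (vars τ rI) ≡ 1 → Fd i
        yes-done h = Flags-yes F i (trans (sym done≡) h)
        no-done : arrs τ aDone (vars τ rI) ≢ 1 → ¬ Fd i
        no-done h = Flags-no F i (h ∘ trans done≡)
      forbidden-spec : ∀ {τ} (i : Fin n) → Unchanged (search forbiddenᵀ) σ τ → vars τ rI ≡ toℕ i →
        (Holds τ forbiddenᵀ → Fd i × ¬ Al i) × (Fails τ forbiddenᵀ → ¬ (Fd i × ¬ Al i))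
      forbidden-spec {τ} i u i≡ = pos , neg′
        where
        Rτ : Loaded τ
        Rτ = Loaded-resp {P = search forbiddenᵀ} refl refl refl refl refl refl refl refl u R
        D : arrs τ aDone ≡ arrs σ aDone
        D = arr≡ u aDone refl
        cls≡ : arrs τ aCls (vars τ rI) ≡ cls G p q r s c i
        cls≡ = trans (cong₂ (λ f j → f j) (arr≡ u aCls refl) i≡) (C i)
        pos : Holds τ forbiddenᵀ → Fd i × ¬ Al i
        pos (d , inj₁ e) = yes-done i Rτ i≡ D d , λ a → proj₁ a (trans (sym cls≡) e)
        pos (d , inj₂ (inj₁ e)) = yes-done i Rτ i≡ D d , λ a
            → proj₁ (proj₂ a) (≡reg i Rτ i≡ D {rr} (Loaded.r≡ Rτ) e)
        pos (d , inj₂ (inj₂ e)) = yes-done i Rτ i≡ D d , λ a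
            → proj₂ (proj₂ a) (≡reg i Rτ i≡ D {rs} (Loaded.s≡ Rτ) e)
        neg′ : Fails τ forbiddenᵀ → ¬ (Fd i × ¬ Al i)
        neg′ (inj₁ d) (f , _) = no-done i Rτ i≡ D d f
        neg′ (inj₂ (a , b , e)) (_ , ¬a) = ¬a ((λ h → a (trans cls≡ h)) ,
          (λ h → b (reg≡ i Rτ i≡ D {rr} (Loaded.r≡ Rτ) h))
              , (λ h → e (reg≡ i Rτ i≡ D {rs} (Loaded.s≡ Rτ) h)))
      third-spec : ∀ {τ} (i : Fin n) → Loaded τ → arrs τ aDone ≡ arrs σ aDone → vars τ rI ≡ toℕ i →
        (Holds τ thirdᵀ → Third i) × (Fails τ thirdᵀ → ¬ Third i)
      third-spec {τ} i Rτ D i≡ =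
          (λ { (d , a , b) → no-done i Rτ i≡ D d , (λ h → a (reg≡ i Rτ i≡ D {rr} (Loaded.r≡ Rτ) h))
              , (λ h → b (reg≡ i Rτ i≡ D {rs} (Loaded.s≡ Rτ) h)) })
        , λ { (inj₁ d) (¬f , _) → ¬f (yes-done i Rτ i≡ D d)
            ; (inj₂ (inj₁ e)) (_ , a , _) → a (≡reg i Rτ i≡ D {rr} (Loaded.r≡ Rτ) e)
            ; (inj₂ (inj₂ e)) (_ , _ , b) → b (≡reg i Rτ i≡ D {rs} (Loaded.s≡ Rτ) e) }
      cost : (12 + costᵀ forbiddenᵀ) * suc n + (3 + ((12 + costᵀ thirdᵀ) * suc n + 2 + 2))
          ≤ 200 * suc (n + total)
      cost = within-≤ (≤ᵇ⇒≤ ((12 + costᵀ forbiddenᵀ) + (3 + ((12 + costᵀ thirdᵀ) + 2 + 2))) 200 _)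
        (scale-within (12 + costᵀ forbiddenᵀ) size≤total ⊕ const-within 3
            ⊕ (scale-within (12 + costᵀ thirdᵀ) size≤total ⊕ const-within 2) ⊕ const-within 2)

    NoJoin : Set
    NoJoin = ∀ {X₁ X₂} → Is2Join G X₁ X₂ → p ∈ X₁ → q ∈ X₁ → c ∈ X₁ → r ∈ X₂ → s ∈ X₂ → ⊥

    -- Success speaks of all separating pairs because the output is not painted yet, and which
    -- colour the forced vertices get depends on the run.
    Answer : State → Set
    Answer σ = (vars σ 5 ≡ 0 × NoJoin)
             ⊎ ((∃[ k ] vars σ 5 ≡ suc k)
               × (∀ {X₁ X₂} → Separates G p q r s c X₁ X₂ →
                  Is2Join G X₁ X₂ × (p ∈ X₁ × q ∈ X₁) × (r ∈ X₂ × s ∈ X₂)))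

    Decided : State → Set
    Decided σ = Flags (arrs σ aDone) Fd × Answer σ

    decide-rule : ∀ {σ} → Marked G p q r s → c ≢ p → c ≢ q → Loaded σ →
                  Runs decide σ (4000 * suc (n + total)) Decided
    decide-rule {σ} M c≢p c≢q R = Runs-mono cost (λ { {σ′} _ (v , F) → F , interpret {σ′} v })
      (Runs-⨾ (setup-rule R) λ {σ₁} u₁ inv →
       Runs-⨾ (explore-rule L p q r s c inv) λ {σ₂} u₂ F →
       verdict-rule
         (Loaded-resp {P = explore} refl refl refl refl refl refl refl refl u₂
           (Loaded-resp {P = setup} refl refl refl refl refl refl refl refl u₁ R))
         (λ v → trans (cong (λ f → f (toℕ v)) (arr≡ u₂ aCls refl))
                      (Classified.cls≡ (Explored.classified (proj₁ (proj₂ (proj₂ inv)))) v))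
         F)
      where
      cost : 600 * suc (n + total) +
          (exploreCost * (12 * suc (n + total)) + 3 + 200 * suc (n + total)) ≤ 4000 * suc (n + total)
      -- 3000 is `exploreCost` times the 12 of `initial-potential`.
      cost = within-≤ (≤ᵇ⇒≤ (600 + (3000 + 3 + 200)) 4000 _)
        (scale-within 600 ≤-refl ⊕ (within {K = 3000}
            (≤-reflexive (sym (*-assoc exploreCost 12 (suc (n + total))))) ⊕ const-within 3)
                ⊕ scale-within 200 ≤-refl)
      -- Forced vertices lie in `X₁`, so all of `X₂` is unforced and a third vertex of `X₂` would
      -- satisfy `Third`.
      no-third : (∀ x → ¬ Third x) → NoJoin
      no-third none J p∈ q∈ c∈ r∈ s∈ = pair-small small (Is2Join.3≤∣X₂∣ J)
        where
        small : ∀ {v} → v ∈ _ → v ≡ r ⊎ v ≡ s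
        small {v} v∈ with v Fin.≟ r | v Fin.≟ s
        ... | yes e | _ = inj₁ e
        ... | no _ | yes e = inj₂ e
        ... | no v≢r | no v≢s = contradiction
          ((λ f → IsPartition.disjoint (Is2Join.partition J)
                    (v , x∈p∩q⁺ (proj₁ (Forced-⊆ G p q r s c M J p∈ q∈ c∈ r∈ s∈ f) , v∈)))
          , v≢r , v≢s) (none v)
      interpret : ∀ {τ} → Verdict τ → Answer τ
      interpret (inj₁ (z , inj₁ (v , f , ¬a))) =
        inj₁ (z , λ J p∈ q∈ c∈ r∈ s∈ → ¬a (proj₂ (Forced-⊆ G p q r s c M J p∈ q∈ c∈ r∈ s∈ f)))
      interpret (inj₁ (z , inj₂ none)) = inj₁ (z , no-third none)
      interpret (inj₂ (nz , allowed , x , ¬f , x≢r , x≢s)) = inj₂ (nz , λ sep →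
          Forced-2Join G p q r s c M sep allowed c≢p c≢q ¬f x≢r x≢s
        , (p∈X₁ G p q r s c M sep allowed , q∈X₁ G p q r s c M sep allowed)
        , (r∈X₂ G p q r s c M sep allowed , s∈X₂ G p q r s c M sep allowed))

-- The memory representation of the graph

cell-applyUpTo : ∀ (f : ℕ → ℕ) (g : ℕ → ℕ) m {i} → i < m → cell (map f (applyUpTo g m)) i ≡ f (g i)
cell-applyUpTo f g (suc m) {zero} _ = refl
cell-applyUpTo f g (suc m) {suc i} (s≤s i<m) = cell-applyUpTo f (g ∘ suc) m i<m

module _ {A : Set} where

  concat-take-suc : ∀ {m} (h : Fin m → List A) i →
    length (concat (take (suc (toℕ i)) (tabulateᴸ h)))
        ≡ length (concat (take (toℕ i) (tabulateᴸ h))) + length (h i)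
  concat-take-suc h Fin.zero = trans (length-++ (h Fin.zero)) (+-identityʳ _)
  concat-take-suc h (Fin.suc i) = begin
    length (h Fin.zero ++ concat (take (suc (toℕ i)) (tabulateᴸ h′)))         ≡⟨ length-++ (h Fin.zero) ⟩
    length (h Fin.zero) + length (concat (take (suc (toℕ i)) (tabulateᴸ h′)))
        ≡⟨ cong (length (h Fin.zero) +_) (concat-take-suc h′ i) ⟩
    length (h Fin.zero) + (length (concat (take (toℕ i) (tabulateᴸ h′))) + length (h′ i))
        ≡⟨ +-assoc (length (h Fin.zero)) _ _ ⟨
    length (h Fin.zero) + length (concat (take (toℕ i) (tabulateᴸ h′))) + length (h′ i)
        ≡⟨ cong (_+ length (h′ i)) (length-++ (h Fin.zero)) ⟨
    length (h Fin.zero ++ concat (take (toℕ i) (tabulateᴸ h′))) + length (h′ i) ∎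
    where
    open ≡-Reasoning
    h′ = h ∘ Fin.suc

  concat-split : ∀ {m} (h : Fin m → List A) i →
    ∃[ rest ] concat (tabulateᴸ h) ≡ concat (take (toℕ i) (tabulateᴸ h)) ++ h i ++ rest
  concat-split h Fin.zero = _ , refl
  concat-split h (Fin.suc i) with concat-split (h ∘ Fin.suc) i
  ... | rest , eq = rest , trans (cong (h Fin.zero ++_) eq) (sym (++-assoc (h Fin.zero) _ _))

  length-concat-tabulate : ∀ {m} (h : Fin m → List A) → length (concat (tabulateᴸ h)) ≡ sum (length ∘ h)
  length-concat-tabulate {zero} h = refl
  length-concat-tabulate {suc m} h =
    trans (length-++ (h Fin.zero)) (cong (length (h Fin.zero) +_) (length-concat-tabulate (h ∘ Fin.suc)))

  -- By deleting the head of `xs` from `ys`; uniqueness keeps the tail inside what remains.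
  Unique-⊆⇒length≤ : ∀ {xs ys : List A} → Unique xs → (∀ {x} → x ∈ᴸ xs → x ∈ᴸ ys) → length xs ≤ length ys
  Unique-⊆⇒length≤ {[]} _ _ = z≤n
  Unique-⊆⇒length≤ {x ∷ xs} (x∉ ∷ uniq) sub with ∈-∃++ (sub (here refl))
  ... | as , bs , refl = begin
    suc (length xs)               ≤⟨ s≤s (Unique-⊆⇒length≤ uniq sub′) ⟩
    suc (length (as ++ bs))       ≡⟨ cong suc (length-++ as) ⟩
    suc (length as + length bs)   ≡⟨ +-suc (length as) (length bs) ⟨
    length as + suc (length bs)   ≡⟨ length-++ as ⟨
    length (as ++ x ∷ bs)         ∎
    where
    open ≤-Reasoning
    sub′ : ∀ {y} → y ∈ᴸ xs → y ∈ᴸ as ++ bs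
    sub′ y∈ with ∈-++⁻ as (sub (there y∈))
    ... | inj₁ h = ∈-++⁺ˡ h
    ... | inj₂ (here refl) = contradiction refl (All-lookup x∉ y∈)
    ... | inj₂ (there h) = ∈-++⁺ʳ as h

Segment-suc : ∀ {n f x l} {xs : List (Fin n)} → Segment (cell f) l xs → Segment (cell (x ∷ f)) (suc l) xs
Segment-suc [] = []
Segment-suc (eq ∷ sg) = eq ∷ Segment-suc sg

Segment-prefix : ∀ {n} (xs : List (Fin n)) ys → Segment (cell (map toℕ (xs ++ ys))) 0 xs
Segment-prefix [] ys = []
Segment-prefix (x ∷ xs) ys = refl ∷ Segment-suc (Segment-prefix xs ys)

Segment-infix : ∀ {n} (as xs bs : List (Fin n)) → Segment (cell (map toℕ (as ++ xs ++ bs))) (length as) xs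
Segment-infix [] xs bs = Segment-prefix xs bs
Segment-infix (a ∷ as) xs bs = Segment-suc (Segment-infix as xs bs)

module _ {n : ℕ} {G : Graph n} (L : AdjacencyLists G) where
  open Graph G
  open AdjacencyLists L

  Input-initial : ∀ Z → Input L (initial L Z)
  Input-initial Z = record
    { size = refl
    ; start = λ v → subst₂ (λ ys l → Segment (cell (map toℕ ys)) l (nbrs v))
        (sym (proj₂ (concat-split nbrs v))) (sym (offset (<⇒≤ (toℕ<n v))))
        (Segment-infix (concat (take (toℕ v) (tabulateᴸ nbrs))) (nbrs v) _)
    ; stop = λ v → trans (offset (toℕ<n v))
        (trans (concat-take-suc nbrs v) (cong (_+ length (nbrs v)) (sym (offset (<⇒≤ (toℕ<n v))))))
    }
    where
    offset : ∀ {i} → i ≤ n → initialArrs L Z 0 i ≡ length (concat (take i (tabulateᴸ nbrs)))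
    offset i≤n = cell-applyUpTo (λ i → length (concat (take i (tabulateᴸ nbrs)))) id (suc n) (s≤s i≤n)

  private
    out : Fin n → List (Fin n × Fin n)
    out v = map (v ,_) (nbrs v)

  -- Handshake inequality: the pairs of a vertex with an entry of its list are distinct, and each is
  -- a listed edge or the reversal of one.
  total≤2*edgeCount : total L ≤ edgeCount G + edgeCount G
  total≤2*edgeCount = begin
    total L                                         ≡⟨ sum-cong-≗ (λ v → sym (length-map (v ,_) (nbrs v))) ⟩
    sum (length ∘ out)                              ≡⟨ length-concat-tabulate out ⟨
    length (concat (tabulateᴸ out))                 ≤⟨ Unique-⊆⇒length≤ out-unique covered ⟩
    length (edges G ++ map swap (edges G))          ≡⟨ length-++ (edges G) ⟩
    edgeCount G + length (map swap (edges G))       ≡⟨ cong (edgeCount G +_) (length-map swap (edges G)) ⟩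
    edgeCount G + edgeCount G                       ∎
    where
    open ≤-Reasoning
    out-unique : Unique (concat (tabulateᴸ out))
    out-unique = Unique.concat⁺
      (All.tabulate⁺ (λ v → Unique.map⁺ ,-injectiveʳ (nbrs-unique v)))
      (AllPairs.tabulate⁺ λ {i} {j} i≢j (h , k) → case ∈-map⁻ (i ,_) h , ∈-map⁻ (j ,_) k of λ
        { ((_ , _ , refl) , (_ , _ , eq)) → i≢j (,-injectiveˡ eq) })
    edge : ∀ {u v} → u Fin.< v → Adj u v → (u , v) ∈ᴸ edges G
    edge u<v uv = ∈-filter⁺ _ (∈-cartesianProduct⁺ (∈-allFin _) (∈-allFin _)) (u<v , uv)
    covered : ∀ {e} → e ∈ᴸ concat (tabulateᴸ out) → e ∈ᴸ edges G ++ map swap (edges G)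
    covered h with ∈-concat⁻′ (tabulateᴸ out) h
    ... | _ , h′ , k with ∈-tabulate⁻ k
    ... | v , refl with ∈-map⁻ (v ,_) h′
    ... | u , u∈ , refl with Fin-<-cmp v u | Equivalence.to (nbrs-adj v u) u∈
    ... | tri< v<u _ _ | vu = ∈-++⁺ˡ (edge v<u vu)
    ... | tri≈ _ eq _  | vu = contradiction vu (adj-irrefl eq)
    ... | tri> _ _ u<v | vu = ∈-++⁺ʳ (edges G) (∈-map⁺ swap (edge u<v (adj-sym vu)))

-- Both sides

output-nothing : ∀ {n s} → vars s 5 ≡ 0 → output n s ≡ nothing
output-nothing eq rewrite eq = refl

output-just : ∀ {n s k} → vars s 5 ≡ suc k → output n s ≡ just (side n s 1 , side n s 2)
output-just eq rewrite eq = refl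

paint : ℕ → ℕ → Program
paint x y = forRange (cond (aDone [ var rI ] == lit 1) (2 [ var rI ]≔ lit x) (2 [ var rI ]≔ lit y))

paint-rule : ∀ x y {n s} {R : Fin n → Set} → vars s 0 ≡ n → Flags (arrs s aDone) R →
  Runs (paint x y) s (16 * suc n) λ s′ → ∀ v → (R v × arrs s′ 2 (toℕ v) ≡ x)
      ⊎ (¬ R v × arrs s′ 2 (toℕ v) ≡ y)
paint-rule x y {n} {s} {R} n≡ F = Runs-mono ≤-refl (λ _ h v → h v (toℕ<n v))
  (forRange-rule body Inv refl refl id step n≡ (λ _ ()))
  where
  body : Program
  body = cond (aDone [ var rI ] == lit 1) (2 [ var rI ]≔ lit x) (2 [ var rI ]≔ lit y)
  Inv : ℕ → State → Set
  Inv k s′ = ∀ v → toℕ v < k → (R v × arrs s′ 2 (toℕ v) ≡ x) ⊎ (¬ R v × arrs s′ 2 (toℕ v) ≡ y)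
  store : ∀ {s′} (i : Fin n) z → vars s′ rI ≡ toℕ i → Inv (toℕ i) s′ → (R i × z ≡ x) ⊎ (¬ R i × z ≡ y) →
          Inv (suc (toℕ i)) (setArr s′ 2 (vars s′ rI) z)
  store {s′} i z i≡ h new v v< rewrite i≡ with update-cases (arrs s′ 2) (toℕ i) {z} (toℕ v)
  ... | inj₂ (v≢i , eq) rewrite eq = h v (≤∧≢⇒< (≤-pred v<) v≢i)
  ... | inj₁ (v≡i , eq) rewrite toℕ-injective v≡i | eq = new
  step : ∀ {s′} (i : Fin n) → Unchanged (paint x y) s s′ → vars s′ rI ≡ toℕ i →
         Inv (toℕ i) s′ → wp body (Inv (suc (toℕ i))) s′
  step {s′} i u i≡ h =
      (λ d → store {s′} i x i≡ h (inj₁ (Flags-yes F i (trans (sym done≡) d) , refl)))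
    , (λ d → store {s′} i y i≡ h (inj₂ (Flags-no F i (d ∘ trans done≡) , refl)))
    where
    done≡ : arrs s′ aDone (vars s′ rI) ≡ arrs s aDone (toℕ i)
    done≡ = cong₂ (λ f j → f j) (arr≡ u aDone refl) i≡

≡⇒∈side : ∀ {n s k} {v : Fin n} → arrs s 2 (toℕ v) ≡ k → v ∈ side n s k
-- A test on literals serves to turn the equation into the Boolean tabulated by `side`.
≡⇒∈side {s = s} {k} {v} h = true⇒∈tabulate (holds⇒true {s} (lit (arrs s 2 (toℕ v)) == lit k) h)

∈side⇒≡ : ∀ {n s k} {v : Fin n} → v ∈ side n s k → arrs s 2 (toℕ v) ≡ k
∈side⇒≡ {s = s} {k} {v} h with arrs s 2 (toℕ v) ≟ k
... | yes eq = eq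
... | no neq = contradiction
  (trans (sym (∈tabulate⇒true h)) (fails⇒false {s} (lit (arrs s 2 (toℕ v)) == lit k) neq)) λ ()

sides-separate : ∀ {n s x y} {R : Fin n → Set} → x ≢ y →
  (∀ v → (R v × arrs s 2 (toℕ v) ≡ x) ⊎ (¬ R v × arrs s 2 (toℕ v) ≡ y)) →
  ∀ v → (R v × v ∈ side n s x × v ∉ side n s y) ⊎ (¬ R v × v ∈ side n s y × v ∉ side n s x)
sides-separate {s = s} x≢y h v with h v
... | inj₁ (r , eq) = inj₁ (r , ≡⇒∈side {s = s} eq , λ v∈ → x≢y (trans (sym eq) (∈side⇒≡ {s = s} v∈)))
... | inj₂ (¬r , eq) = inj₂ (¬r , ≡⇒∈side {s = s} eq , λ v∈ → x≢y (trans (sym (∈side⇒≡ {s = s} v∈)) eq))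

load : ℕ → ℕ → ℕ → ℕ → Program
load i j k l = rp ≔ var i ⨾ rq ≔ var j ⨾ rr ≔ var k ⨾ rs ≔ var l

outsideᵀ : Test
outsideᵀ = neg (var rI == var 1) && neg (var rI == var 2) && neg (var rI == var 3) && neg (var rI == var 4)

mirrored bothSides find2Join : Program
-- Registers 1 to 4 hold a₁, a₂, b₁, b₂, so `p`, `q` become a₂, b₂. The forced vertices then form
-- the second side and are painted 2.
mirrored  = load 2 4 1 3 ⨾ decide ⨾ cond (var 5 == lit 0) skip (paint 2 1)
-- `decide` searches again and overwrites `rFound`; the copy of `c` in `rc` survives for the
-- mirrored run.
bothSides = (rc ≔ dec (var rFound) ⨾ load 1 3 2 4) ⨾ decide ⨾ cond (var 5 == lit 0) mirrored (paint 1 2)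
find2Join = search outsideᵀ ⨾ cond (var rFound == lit 0) (5 ≔ lit 0) bothSides

module _ {n : ℕ} {G : Graph n} (L : AdjacencyLists G) (Z : Tuple n) (proper : Proper G Z) where
  open Graph G
  open Tuple Z
  open Proper proper

  private
    marked₁ : Marked G a₁ b₁ a₂ b₂
    marked₁ = record { p≢q = a₁≢b₁ ; r≢s = a₂≢b₂ ; pr = a₁a₂∈E ; qs = b₁b₂∈E ; ¬ps = a₁b₂∉E ; ¬qr = b₁a₂∉E }

    marked₂ : Marked G a₂ b₂ a₁ b₁
    marked₂ = record { p≢q = a₂≢b₂ ; r≢s = a₁≢b₁ ; pr = adj-sym a₁a₂∈E ; qs = adj-sym b₁b₂∈E
                     ; ¬ps = λ h → b₁a₂∉E (adj-sym h) ; ¬qr = λ h → a₁b₂∉E (adj-sym h) }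

  record Start (σ : State) : Set where
    field
      input : Input L σ
      a₁≡ : vars σ 1 ≡ toℕ a₁
      a₂≡ : vars σ 2 ≡ toℕ a₂
      b₁≡ : vars σ 3 ≡ toℕ b₁
      b₂≡ : vars σ 4 ≡ toℕ b₂

  Start-resp : ∀ {P σ σ′} → writesVar P 0 ≡ false → writesArr P 0 ≡ false → writesArr P 1 ≡ false →
    writesVar P 1 ≡ false → writesVar P 2 ≡ false → writesVar P 3 ≡ false → writesVar P 4 ≡ false →
    Unchanged P σ σ′ → Start σ → Start σ′
  Start-resp w0 x0 x1 w1 w2 w3 w4 u S = record
    { input = Input-resp L w0 x0 x1 u input
    ; a₁≡ = trans (var≡ u 1 w1) a₁≡ ; a₂≡ = trans (var≡ u 2 w2) a₂≡
    ; b₁≡ = trans (var≡ u 3 w3) b₁≡ ; b₂≡ = trans (var≡ u 4 w4) b₂≡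
    }
    where open Start S

  Outside : Fin n → Set
  Outside c = c ≢ a₁ × c ≢ a₂ × c ≢ b₁ × c ≢ b₂

  Answered : State → Set
  Answered σ = Correct G Z (output n σ)

  -- What the failed first run hands to the second: in any remaining candidate, `c` lies in `X₂`.
  Excluded : Fin n → Set
  Excluded c = ∀ {X₁ X₂} → Compatible2Join G Z (X₁ , X₂) → c ∉ X₁

  answered-no : ∀ {σ} → vars σ 5 ≡ 0 → (∀ {X₁ X₂} → ¬ Compatible2Join G Z (X₁ , X₂)) → Answered σ
  answered-no {σ} eq none = subst (Correct G Z)
      (sym (output-nothing {n} {σ} eq)) λ { ((X₁ , X₂) , J) → none J }

  answered-yes : ∀ {σ k} → vars σ 5 ≡ suc k → Compatible2Join G Z (side n σ 1 , side n σ 2) → Answered σ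
  answered-yes {σ} eq J = subst (Correct G Z) (sym (output-just {n} {σ} eq)) J

  mirrored-rule : ∀ {σ} c → Start σ → vars σ rc ≡ toℕ c → Outside c → Excluded c →
                  Runs mirrored σ (4100 * suc (n + total L)) Answered
  mirrored-rule {σ} c S c≡ (_ , c≢a₂ , _ , c≢b₂) excl = Runs-mono cost (λ _ → id)
    (Runs-⨾ (Runs-wp (load 2 4 1 3) {Q = Loaded L a₂ b₂ a₁ b₁ c}
        record { input = record { size = Input.size input ; start = Input.start input
            ; stop = Input.stop input }
               ; p≡ = a₂≡ ; q≡ = b₂≡ ; r≡ = a₁≡ ; s≡ = b₁≡ ; c≡ = c≡ }) λ {σ₁} u₁ R →
     Runs-⨾ (decide-rule L a₂ b₂ a₁ b₁ c marked₂ c≢a₂ c≢b₂ R) λ {σ₂} u₂ D →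
     let (F , h) = D in
     Runs-cond
       (λ z → Runs-wp skip (answered-no {σ₂} z (none {σ₂} h z)))
       (λ nz → Runs-mono ≤-refl (λ u₃ sep → finish h nz u₃ sep)
         (paint-rule 2 1 (trans (var≡ u₂ 0 refl) (Input.size (Loaded.input R))) F)))
    where
    open Start S
    none : ∀ {τ} → Answer L a₂ b₂ a₁ b₁ c τ → vars τ 5 ≡ 0 → ∀ {X₁ X₂} → ¬ Compatible2Join G Z (X₁ , X₂)
    none (inj₂ ((_ , eq) , _)) z = contradiction (trans (sym z) eq) λ ()
    none (inj₁ (_ , no-join)) _ {X₁} {X₂} C@(J , (a₁∈ , b₁∈) , (a₂∈ , b₂∈))
      with x∈p∪q⁻ X₁ X₂ (IsPartition.covers (Is2Join.partition J) c)
    ... | inj₁ c∈ = excl C c∈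
    ... | inj₂ c∈ = no-join (Is2Join-sym J) a₂∈ b₂∈ c∈ a₁∈ b₁∈
    finish : ∀ {τ τ′} → Answer L a₂ b₂ a₁ b₁ c τ → vars τ 5 ≢ 0 → Unchanged (paint 2 1) τ τ′ →
      (∀ v → (Forced G a₂ b₂ a₁ b₁ c v × arrs τ′ 2 (toℕ v) ≡ 2)
          ⊎ (¬ Forced G a₂ b₂ a₁ b₁ c v × arrs τ′ 2 (toℕ v) ≡ 1)) →
      Answered τ′
    finish (inj₁ (z , _)) nz _ _ = contradiction z nz
    finish {τ} {τ′} (inj₂ ((k , eq) , build)) _ u sep with build (sides-separate {s = τ′} (λ ()) sep)
    ... | J , on₂ , on₁ = answered-yes {τ′} (trans (var≡ u 5 refl) eq) (Is2Join-sym J , on₁ , on₂)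
    cost : 8 + (4000 * suc (n + total L) + (3 + (1 + 16 * suc n))) ≤ 4100 * suc (n + total L)
    cost = within-≤ (≤ᵇ⇒≤ (8 + (4000 + (3 + (1 + 16)))) 4100 _)
      (const-within 8 ⊕ scale-within 4000 ≤-refl ⊕ const-within 3 ⊕ const-within 1
          ⊕ scale-within 16 (size≤total L))

  bothSides-rule : ∀ {σ} c → Start σ → vars σ rFound ≡ suc (toℕ c) → Outside c →
               Runs bothSides σ (8200 * suc (n + total L)) Answered
  bothSides-rule {σ} c S c≡ out@(c≢a₁ , _ , c≢b₁ , _) = Runs-mono cost (λ _ → id)
    (Runs-⨾ (Runs-wp (rc ≔ dec (var rFound) ⨾ load 1 3 2 4) {Q = Loaded L a₁ b₁ a₂ b₂ c}
        record { input = record { size = Input.size input ; start = Input.start input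
            ; stop = Input.stop input }
               ; p≡ = a₁≡ ; q≡ = b₁≡ ; r≡ = a₂≡ ; s≡ = b₂≡ ; c≡ = cong pred c≡ }) λ {σ₁} u₁ R →
     Runs-⨾ (decide-rule L a₁ b₁ a₂ b₂ c marked₁ c≢a₁ c≢b₁ R) λ {σ₂} u₂ D →
     let (F , h) = D in
     Runs-cond
       (λ z → mirrored-rule c
                (Start-resp {P = decide} refl refl refl refl refl refl refl u₂
                  (Start-resp {P = rc ≔ dec (var rFound) ⨾ load 1 3 2 4} refl refl refl refl refl
                      refl refl u₁ S))
                (trans (var≡ u₂ rc refl) (Loaded.c≡ R)) out (excluded {σ₂} h z))
       (λ nz → Runs-mono ≤-refl (λ u₃ sep → finish h nz u₃ sep)
         (paint-rule 1 2 (trans (var≡ u₂ 0 refl) (Input.size (Loaded.input R))) F)))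
    where
    open Start S
    excluded : ∀ {τ} → Answer L a₁ b₁ a₂ b₂ c τ → vars τ 5 ≡ 0 → Excluded c
    excluded (inj₂ ((_ , eq) , _)) z = contradiction (trans (sym z) eq) λ ()
    excluded (inj₁ (_ , no-join)) _ (J , (a₁∈ , b₁∈) , (a₂∈ , b₂∈)) c∈ = no-join J a₁∈ b₁∈ c∈ a₂∈ b₂∈
    finish : ∀ {τ τ′} → Answer L a₁ b₁ a₂ b₂ c τ → vars τ 5 ≢ 0 → Unchanged (paint 1 2) τ τ′ →
      (∀ v → (Forced G a₁ b₁ a₂ b₂ c v × arrs τ′ 2 (toℕ v) ≡ 1)
          ⊎ (¬ Forced G a₁ b₁ a₂ b₂ c v × arrs τ′ 2 (toℕ v) ≡ 2)) →
      Answered τ′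
    finish (inj₁ (z , _)) nz _ _ = contradiction z nz
    finish {τ} {τ′} (inj₂ ((k , eq) , build)) _ u sep =
      answered-yes {τ′} (trans (var≡ u 5 refl) eq) (build (sides-separate {s = τ′} (λ ()) sep))
    cost : 11 + (4000 * suc (n + total L) + (3 + (4100 * suc (n + total L) + 16 * suc n)))
        ≤ 8200 * suc (n + total L)
    cost = within-≤ (≤ᵇ⇒≤ (11 + (4000 + (3 + (4100 + 16)))) 8200 _)
      (const-within 11 ⊕ scale-within 4000 ≤-refl ⊕ const-within 3 ⊕ scale-within 4100 ≤-refl
          ⊕ scale-within 16 (size≤total L))

  find2Join-rule : ∀ {σ} → Start σ → Runs find2Join σ (8300 * suc (n + total L)) Answered
  find2Join-rule {σ} S = Runs-mono cost (λ _ → id)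
    (Runs-⨾ (search-rule outsideᵀ Outside spec (Input.size (Start.input S))) λ {σ₁} u₁ h →
     Runs-cond
       (λ z → Runs-wp (5 ≔ lit 0) (answered-no {setVar σ₁ 5 0} refl (none {σ₁} h z)))
       (λ nz → found u₁ h nz))
    where
    spec : ∀ {τ} (i : Fin n) → Unchanged (search outsideᵀ) σ τ → vars τ rI ≡ toℕ i →
      (Holds τ outsideᵀ → Outside i) × (Fails τ outsideᵀ → ¬ Outside i)
    spec {τ} i u i≡ =
        (λ { (h₁ , h₂ , h₃ , h₄) → h₁ ∘ reg≡ a₁≡ , h₂ ∘ reg≡ a₂≡ , h₃ ∘ reg≡ b₁≡ , h₄ ∘ reg≡ b₂≡ })
      , λ { (inj₁ e) (h , _) → h (≡reg a₁≡ e)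
          ; (inj₂ (inj₁ e)) (_ , h , _) → h (≡reg a₂≡ e)
          ; (inj₂ (inj₂ (inj₁ e))) (_ , _ , h , _) → h (≡reg b₁≡ e)
          ; (inj₂ (inj₂ (inj₂ e))) (_ , _ , _ , h) → h (≡reg b₂≡ e) }
      where
      open Start (Start-resp {P = search outsideᵀ} refl refl refl refl refl refl refl u S)
      ≡reg : ∀ {x y} → vars τ x ≡ toℕ y → vars τ rI ≡ vars τ x → i ≡ y
      ≡reg e h = toℕ-injective (trans (sym i≡) (trans h e))
      reg≡ : ∀ {x y} → vars τ x ≡ toℕ y → i ≡ y → vars τ rI ≡ vars τ x
      reg≡ e refl = trans i≡ (sym e)
    none : ∀ {τ} → SearchResult Outside τ → vars τ rFound ≡ 0 → ∀ {X₁ X₂} → ¬ Compatible2Join G Z (X₁ , X₂)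
    none (inj₁ (_ , eq , _)) z = contradiction (trans (sym z) eq) λ ()
    -- If the tuple exhausts the vertices, `X₁` can contain only a₁ and b₁, which is too few.
    none (inj₂ (_ , no-outside)) _ {X₁} {X₂} (J , _ , (a₂∈ , b₂∈)) = pair-small small (Is2Join.3≤∣X₁∣ J)
      where
      apart : ∀ {u v} → u ∈ X₁ → v ∈ X₂ → u ≢ v
      apart u∈ v∈ refl = IsPartition.disjoint (Is2Join.partition J) (_ , x∈p∩q⁺ (u∈ , v∈))
      small : ∀ {v} → v ∈ X₁ → v ≡ a₁ ⊎ v ≡ b₁
      small {v} v∈ with v Fin.≟ a₁ | v Fin.≟ b₁
      ... | yes e | _ = inj₁ e
      ... | no _ | yes e = inj₂ e
      ... | no v≢a₁ | no v≢b₁ = contradiction (v≢a₁ , apart v∈ a₂∈ , v≢b₁ , apart v∈ b₂∈) (no-outside v)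
    found : ∀ {τ} → Unchanged (search outsideᵀ) σ τ → SearchResult Outside τ → vars τ rFound ≢ 0 →
            Runs bothSides τ (8200 * suc (n + total L)) Answered
    found u (inj₁ (c , eq , out)) _ = bothSides-rule c
        (Start-resp {P = search outsideᵀ} refl refl refl refl refl refl refl u S) eq out
    found u (inj₂ (z , _)) nz = contradiction z nz
    cost : (12 + costᵀ outsideᵀ) * suc n + (3 + (2 + 8200 * suc (n + total L))) ≤ 8300 * suc (n + total L)
    cost = within-≤ (≤ᵇ⇒≤ ((12 + costᵀ outsideᵀ) + (3 + (2 + 8200))) 8300 _)
      (scale-within (12 + costᵀ outsideᵀ) (size≤total L) ⊕ const-within 3 ⊕ const-within 2
          ⊕ scale-within 8200 ≤-refl)

-- The vertex argument gives 1 ≤ n, so the `suc` is absorbed by a second n, and the sum is at most 2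
-- (n + m); hence 16600 = 2 * 8300.
linear : ∀ {n m D} → Fin n → D ≤ m + m → 8300 * suc (n + D) ≤ 16600 * (n + m)
linear {n} {m} {D} v D≤ = begin
  8300 * suc (n + D)             ≤⟨ *-monoʳ-≤ 8300
      (+-mono-≤ (≤-trans (s≤s z≤n) (toℕ<n v)) (+-monoʳ-≤ n D≤)) ⟩
  8300 * (n + (n + (m + m)))     ≡⟨ cong (8300 *_) (double n m) ⟩
  8300 * (2 * (n + m))           ≡⟨ *-assoc 8300 2 (n + m) ⟨
  16600 * (n + m)                ∎
  where
  open ≤-Reasoning
  open +-*-Solver using (_:+_; _:*_; _:=_; con)
  double : ∀ n m → n + (n + (m + m)) ≡ 2 * (n + m)
  double = +-*-Solver.solve 2 (λ n m → n :+ (n :+ (m :+ m)) := con 2 :* (n :+ m)) refl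

corollary2p2 : ∃[ P ] ∃[ c ] (∀ (n : ℕ) (G : Graph n) (L : AdjacencyLists G) (Z : Tuple n) → Proper G Z →
    ∃[ s ] ∃[ t ] ((⟨ P , initial L Z ⟩⇓[ t ] s)
    × (t ≤ c * (n + edgeCount G))
    × Correct G Z (output n s)))
corollary2p2 = find2Join , 16600 , λ n G L Z proper →
  Runs-mono (linear (Tuple.a₁ Z) (total≤2*edgeCount L)) (λ _ → id)
    (find2Join-rule L Z proper record
      { input = Input-initial L Z ; a₁≡ = refl ; a₂≡ = refl ; b₁≡ = refl ; b₂≡ = refl })
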